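{- There is a constant $C \ge 4$ such that $\mathrm{Sun}(p,k) \le (C p \log k)^k$ for all integers $p,k \ge 2$.
   Context: A sunflower with $p$ petals is a family of $p$ sets whose pairwise intersections are all identical (the common intersection may be empty). $\mathrm{Sun}(p,k)$ denotes the smallest natural number $s$ such that any family of at least $s$ distinct $k$-element sets contains a sunflower with $p$ petals. $\log$ denotes the natural logarithm. -}

module Defs where

open import Data.Nat using (ℕ; zero; suc; _+_; _*_; _^_; _≤_; _<_)
open import Data.List using (List; length)
open import Data.List.Membership.Propositional using (_∈_)
open import Data.List.Relation.Unary.All using (All)
open import Data.List.Relation.Unary.Unique.Propositional using (Unique)
open import Data.Fin.Subset using (Subset; _∩_; ∣_∣)
open import Data.Product using (Σ; _×_; ∃)
open import Relation.Binary.PropositionalEquality using (_≡_; _≢_)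

-- Sets are subsets of a finite ground set Fin n (n arbitrary); a family is a
-- duplicate-free list of such subsets.

HasSunflower : {n : ℕ} → ℕ → List (Subset n) → Set
HasSunflower {n} p F =
  Σ (List (Subset n)) λ S →
    length S ≡ p × Unique S × All (λ A → A ∈ F) S ×
    Σ (Subset n) λ Y → ∀ {A B} → A ∈ S → B ∈ S → A ≢ B → A ∩ B ≡ Y

SunProperty : ℕ → ℕ → ℕ → Set
SunProperty p k s =
  ∀ (n : ℕ) (F : List (Subset n)) → Unique F → All (λ A → ∣ A ∣ ≡ k) F →
    s ≤ length F → HasSunflower p F

IsSun : ℕ → ℕ → ℕ → Set
IsSun p k s = SunProperty p k s × (∀ s′ → SunProperty p k s′ → s ≤ s′)

-- e^m ≤ K  (e = Euler's number), via e^m = sup_{j ≥ 1} (1 + 1/j)^(j m):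
-- for all j ≥ 1, (j+1)^(j m) ≤ K · j^(j m).
ExpLe : ℕ → ℕ → Set
ExpLe m K = ∀ (i : ℕ) → let j = suc i in suc j ^ (j * m) ≤ K * j ^ (j * m)

-- s ≤ (C · p · log k)^k, with log the natural logarithm, for C·p > 0, k ≥ 1.
-- Equivalently s^(1/k)/(C p) ≤ log k, i.e. every nonnegative rational m/n
-- (n ≥ 1) with m/n < s^(1/k)/(C p), i.e. (m C p)^k < s n^k, satisfies
-- m/n ≤ log k, i.e. e^m ≤ k^n.
LeCpLogPow : ℕ → ℕ → ℕ → ℕ → Set
LeCpLogPow s C p k =
  ∀ (m n : ℕ) → 1 ≤ n → (m * C * p) ^ k < s * n ^ k → ExpLe m (k ^ n)

{-# OPTIONS --safe #-}

-- After Alweiss-Lovett-Wu-Zhang, Rao and Bell-Chueluecha-Warnke. Put L = ⌊log₂ k⌋ + 1, q = 2pL and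
-- R = 16q. If a family of k-sets has more than R^k members, pass to the link of a maximal set A with
-- R^k < deg A * R^∣A∣; it is spread: deg T * R^∣T∣ is at most its number M of members.
-- Colour the points with the q colours (b , i), b < 2p, i < L, uniformly at random. For each block b
-- the colours (b , L-1), ..., (b , 0) are exposed one after the other. Exposing a class W of colour
-- (b , i) replaces a member U by a minimal fragment U′ ─ W ⊆ U ─ W, and discards it if the fragment
-- has size ≥ 2^i. As in the Park-Pham argument, a fragment T is a subset of a member determined by
-- W ∪ T alone, so few fragments are large: together all rounds discard at most a third of the members
-- on average. What survives is empty, i.e. comes from a member inside block b. Hence for some
-- colouring at least p of the 2p blocks contain a member, and these p disjoint members of the link
-- give a sunflower with kernel A.
module Submission where

open import Defs
open import Data.Bool using (true; false; if_then_else_)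
import Data.Bool.Properties as Bool
open import Data.Empty using (⊥-elim)
open import Data.Fin using (Fin; zero; suc; toℕ)
open import Data.Fin.Properties using (toℕ<n; toℕ-injective)
open import Data.Fin.Subset using (Subset; _∩_; _∪_; _─_; ⋃; ∣_∣; _⊆_; _⊂_; ⊥; Nonempty) renaming (_∈_ to _∈ˢ_; _∉_ to _∉ˢ_)
open import Data.Fin.Subset.Properties
  using (_⊆?_; _∈?_; _⊂?_; nonempty?; anySubset?; ⊥⊆; ⊆-refl; ⊆-trans; ⊆-antisym; drop-∷-⊆; p─q⊆p; x∈p∧x∉q⇒x∈p─q;
         ∣⊥∣≡0; ∣p∣≤n; p⊆p∪q; q⊆p∪q; x∈p∪q⁻; x∈p∪q⁺; x∈p∩q⁺; x∈p∩q⁻; p⊂q⇒∣p∣<∣q∣; ∣p─q∣≤∣p∣;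
         x∈p⇒∣p-x∣<∣p∣; Empty-unique)
open import Data.List using (List; []; _∷_; length; map; _++_; filter; cartesianProductWith; cartesianProduct; upTo; allFin; take)
open import Data.List.Membership.Propositional using (_∈_; find; lose)
open import Data.List.Membership.Propositional.Properties
  using (∈-cartesianProductWith⁺; ∈-cartesianProduct⁺; ∈-upTo⁺; ∈-filter⁻; ∈-map⁺; ∈-map⁻; ∈-length)
open import Data.List.Properties using (length-map; length-++; length-take; length-upTo; length-tabulate; map-∘; map-id-local)
open import Data.List.Relation.Unary.All as All using (All; []; _∷_)
import Data.List.Relation.Unary.All.Properties as All
open import Data.List.Relation.Unary.AllPairs as AllPairs using (AllPairs; []; _∷_)
import Data.List.Relation.Unary.AllPairs.Properties as AllPairs
open import Data.List.Relation.Unary.Any as Any using (here; there)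
open import Data.List.Relation.Unary.Unique.Propositional using (Unique)
import Data.List.Relation.Unary.Unique.Propositional.Properties as Unique
open import Data.Nat
open import Data.Nat.Properties
open import Data.Nat.Solver using (module +-*-Solver)
open import Data.Product using (Σ; _×_; _,_; ∃; proj₁; proj₂)
import Data.Product.Properties as Product
import Data.Sum as Sum
open import Data.Sum using (_⊎_; inj₁; inj₂)
open import Data.Vec as Vec using (Vec; []; _∷_; here; there; zipWith; lookup; insertAt; removeAt)
open import Data.Vec.Properties
  using (lookup-map; lookup-zipWith; []=⇒lookup; lookup⇒[]=; insertAt-removeAt; removeAt-insertAt; ≡-dec)
open import Function using (_∘_; case_of_)
open import Relation.Binary.Definitions using (Symmetric)
open import Relation.Binary.PropositionalEquality using (_≡_; _≢_; refl; sym; trans; cong; cong₂; subst; subst₂)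
open import Relation.Nullary using (Dec; yes; no; ¬_; ¬?; does)
open import Relation.Nullary.Decidable using (_×-dec_; _→-dec_; map′)
open import Relation.Unary using (Decidable)

-- Finite sums and enumeration

private
  variable
    A B : Set

∑ : List A → (A → ℕ) → ℕ
∑ []       f = 0
∑ (x ∷ xs) f = f x + ∑ xs f

𝟙 : {P : Set} → Dec P → ℕ
𝟙 (yes _) = 1
𝟙 (no _)  = 0

𝟙-yes : {P : Set} → P → (d : Dec P) → 𝟙 d ≡ 1
𝟙-yes p (yes _) = refl
𝟙-yes p (no ¬p) = ⊥-elim (¬p p)

𝟙-no : {P : Set} → ¬ P → (d : Dec P) → 𝟙 d ≡ 0
𝟙-no ¬p (yes p) = ⊥-elim (¬p p)
𝟙-no ¬p (no _)  = refl

𝟙-mono : {P Q : Set} (d : Dec P) (e : Dec Q) → (P → Q) → 𝟙 d ≤ 𝟙 e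
𝟙-mono (yes p) e f = ≤-reflexive (sym (𝟙-yes (f p) e))
𝟙-mono (no _)  e f = z≤n

𝟙≤1 : {P : Set} (d : Dec P) → 𝟙 d ≤ 1
𝟙≤1 (yes _) = s≤s z≤n
𝟙≤1 (no _)  = z≤n

∑-mono-∈ : (xs : List A) {f g : A → ℕ} → (∀ {x} → x ∈ xs → f x ≤ g x) → ∑ xs f ≤ ∑ xs g
∑-mono-∈ []       h = z≤n
∑-mono-∈ (x ∷ xs) h = +-mono-≤ (h (here refl)) (∑-mono-∈ xs (h ∘ there))

∑-mono : (xs : List A) {f g : A → ℕ} → (∀ x → f x ≤ g x) → ∑ xs f ≤ ∑ xs g
∑-mono xs h = ∑-mono-∈ xs (λ {x} _ → h x)

∑-cong : (xs : List A) {f g : A → ℕ} → (∀ x → f x ≡ g x) → ∑ xs f ≡ ∑ xs g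
∑-cong []       h = refl
∑-cong (x ∷ xs) h = cong₂ _+_ (h x) (∑-cong xs h)

∑-const : (xs : List A) (v : ℕ) → ∑ xs (λ _ → v) ≡ length xs * v
∑-const []       v = refl
∑-const (x ∷ xs) v = cong (v +_) (∑-const xs v)

∑-+ : (xs : List A) (f g : A → ℕ) → ∑ xs (λ x → f x + g x) ≡ ∑ xs f + ∑ xs g
∑-+ []       f g = refl
∑-+ (x ∷ xs) f g rewrite ∑-+ xs f g =
  solve 4 (λ a b c d → a :+ b :+ (c :+ d) := a :+ c :+ (b :+ d)) refl (f x) (g x) (∑ xs f) (∑ xs g)
  where open +-*-Solver

∑-*ˡ : (v : ℕ) (xs : List A) (f : A → ℕ) → ∑ xs (λ x → v * f x) ≡ v * ∑ xs f
∑-*ˡ v []       f = sym (*-zeroʳ v)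
∑-*ˡ v (x ∷ xs) f rewrite ∑-*ˡ v xs f = sym (*-distribˡ-+ v (f x) (∑ xs f))

∑-swap : (xs : List A) (ys : List B) (f : A → B → ℕ) →
         ∑ xs (λ x → ∑ ys (f x)) ≡ ∑ ys (λ y → ∑ xs (λ x → f x y))
∑-swap []       ys f = sym (trans (∑-const ys 0) (*-zeroʳ (length ys)))
∑-swap (x ∷ xs) ys f rewrite ∑-swap xs ys f = sym (∑-+ ys (f x) (λ y → ∑ xs (λ x → f x y)))

∑-++ : (xs ys : List A) (f : A → ℕ) → ∑ (xs ++ ys) f ≡ ∑ xs f + ∑ ys f
∑-++ []       ys f = refl
∑-++ (x ∷ xs) ys f rewrite ∑-++ xs ys f = sym (+-assoc (f x) (∑ xs f) (∑ ys f))

∑-map : (g : A → B) (xs : List A) (f : B → ℕ) → ∑ (map g xs) f ≡ ∑ xs (f ∘ g)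
∑-map g []       f = refl
∑-map g (x ∷ xs) f = cong (f (g x) +_) (∑-map g xs f)

∑-∈ : {x : A} {xs : List A} (f : A → ℕ) → x ∈ xs → f x ≤ ∑ xs f
∑-∈ f (here refl)          = m≤m+n _ _
∑-∈ f (there {x = y} x∈xs) = ≤-trans (∑-∈ f x∈xs) (m≤n+m _ (f y))

∑-filter-≤ : {P : A → Set} (P? : Decidable P) (xs : List A) (f : A → ℕ) → ∑ (filter P? xs) f ≤ ∑ xs f
∑-filter-≤ P? []       f = z≤n
∑-filter-≤ P? (x ∷ xs) f with does (P? x)
... | true  = +-monoʳ-≤ (f x) (∑-filter-≤ P? xs f)
... | false = ≤-trans (∑-filter-≤ P? xs f) (m≤n+m _ (f x))

-- If the head falls short of `v`, the tail has to make up for it, so its average is again at least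
-- `v`. This is how one good colouring is extracted from an average.
∑-pigeonhole : {v : ℕ} (x : A) (xs : List A) (f : A → ℕ) → length (x ∷ xs) * v ≤ ∑ (x ∷ xs) f →
               ∃ λ y → v ≤ f y
∑-pigeonhole {v = v} x [] f h = x , subst₂ _≤_ (+-identityʳ v) (+-identityʳ (f x)) h
∑-pigeonhole {v = v} x (y ∷ ys) f h with v ≤? f x
... | yes p = x , p
... | no ¬p = ∑-pigeonhole y ys f
                (+-cancelˡ-≤ v _ _ (≤-trans h (+-monoˡ-≤ _ (<⇒≤ (≰⇒> ¬p)))))

∑-𝟙 : {P : A → Set} (P? : Decidable P) (xs : List A) → ∑ xs (λ x → 𝟙 (P? x)) ≡ length (filter P? xs)
∑-𝟙 P? [] = refl
∑-𝟙 P? (x ∷ xs) with P? x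
... | yes _ = cong suc (∑-𝟙 P? xs)
... | no _  = ∑-𝟙 P? xs

length-filter+∑ : {P Q : A → Set} (P? : Decidable P) (Q? : Decidable Q) → (∀ x → ¬ P x → Q x) →
                  (xs : List A) → length xs ≤ length (filter P? xs) + ∑ xs (λ x → 𝟙 (Q? x))
length-filter+∑ P? Q? h [] = z≤n
length-filter+∑ P? Q? h (x ∷ xs) with P? x
... | yes _ = s≤s (≤-trans (length-filter+∑ P? Q? h xs) (+-monoʳ-≤ (length (filter P? xs)) (m≤n+m _ (𝟙 (Q? x)))))
... | no ¬p rewrite 𝟙-yes (h x ¬p) (Q? x) =
  subst (suc (length xs) ≤_) (sym (+-suc _ _)) (s≤s (length-filter+∑ P? Q? h xs))

vecs : List A → (n : ℕ) → List (Vec A n)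
vecs xs zero    = [] ∷ []
vecs xs (suc n) = cartesianProductWith _∷_ xs (vecs xs n)

∈-vecs : {xs : List A} → (∀ x → x ∈ xs) → ∀ {n} (v : Vec A n) → v ∈ vecs xs n
∈-vecs all []      = here refl
∈-vecs all (x ∷ v) = ∈-cartesianProductWith⁺ _∷_ (all x) (∈-vecs all v)

length-cartesianProductWith : {C : Set} (f : A → B → C) (xs : List A) (ys : List B) →
                              length (cartesianProductWith f xs ys) ≡ length xs * length ys
length-cartesianProductWith f []       ys = refl
length-cartesianProductWith f (x ∷ xs) ys =
  trans (length-++ (map (f x) ys)) (cong₂ _+_ (length-map (f x) ys) (length-cartesianProductWith f xs ys))

length-vecs : (xs : List A) (n : ℕ) → length (vecs xs n) ≡ length xs ^ n
length-vecs xs zero    = refl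
length-vecs xs (suc n) =
  trans (length-cartesianProductWith _∷_ xs (vecs xs n)) (cong (length xs *_) (length-vecs xs n))

∑-vecs-suc : (xs : List A) (n : ℕ) (f : Vec A (suc n) → ℕ) →
             ∑ (vecs xs (suc n)) f ≡ ∑ xs (λ x → ∑ (vecs xs n) (λ v → f (x ∷ v)))
∑-vecs-suc {A = A} xs n f = go xs
  where
  go : (ys : List A) → ∑ (cartesianProductWith _∷_ ys (vecs xs n)) f ≡ ∑ ys (λ x → ∑ (vecs xs n) (λ v → f (x ∷ v)))
  go []       = refl
  go (y ∷ ys) = trans (∑-++ (map (y ∷_) (vecs xs n)) _ f) (cong₂ _+_ (∑-map (y ∷_) (vecs xs n) f) (go ys))

subsets : (n : ℕ) → List (Subset n)
subsets = vecs (true ∷ false ∷ [])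

∈-subsets : ∀ {n} (T : Subset n) → T ∈ subsets n
∈-subsets = ∈-vecs λ { true → here refl ; false → there (here refl) }

∑-⊆ : ∀ {n} (U : Subset n) → ∑ (subsets n) (λ T → 𝟙 (T ⊆? U)) ≤ 2 ^ ∣ U ∣
∑-⊆ [] = s≤s z≤n
∑-⊆ {suc n} (true ∷ U) = begin
  ∑ (subsets (suc n)) (λ T → 𝟙 (T ⊆? (true ∷ U)))
    ≡⟨ ∑-vecs-suc _ n _ ⟩
  ∑ (subsets n) (λ T → 𝟙 ((true ∷ T) ⊆? (true ∷ U))) + (∑ (subsets n) (λ T → 𝟙 ((false ∷ T) ⊆? (true ∷ U))) + 0)
    ≤⟨ +-mono-≤ (h true) (+-monoˡ-≤ 0 (h false)) ⟩
  2 ^ ∣ U ∣ + (2 ^ ∣ U ∣ + 0) ∎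
  where
  open ≤-Reasoning
  h : ∀ b → ∑ (subsets n) (λ T → 𝟙 ((b ∷ T) ⊆? (true ∷ U))) ≤ 2 ^ ∣ U ∣
  h b = ≤-trans (∑-mono (subsets n) (λ T → 𝟙-mono ((b ∷ T) ⊆? (true ∷ U)) (T ⊆? U) (λ s → drop-∷-⊆ s))) (∑-⊆ U)
∑-⊆ {suc n} (false ∷ U) = begin
  ∑ (subsets (suc n)) (λ T → 𝟙 (T ⊆? (false ∷ U)))
    ≡⟨ ∑-vecs-suc _ n _ ⟩
  ∑ (subsets n) (λ T → 𝟙 ((true ∷ T) ⊆? (false ∷ U))) + (∑ (subsets n) (λ T → 𝟙 ((false ∷ T) ⊆? (false ∷ U))) + 0)
    ≤⟨ +-mono-≤ (≤-reflexive (∑-cong (subsets n) (λ T → 𝟙-no (λ s → case s here of λ ()) ((true ∷ T) ⊆? (false ∷ U)))))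
                (+-monoˡ-≤ 0 (≤-trans (∑-mono (subsets n) (λ T → 𝟙-mono ((false ∷ T) ⊆? (false ∷ U)) (T ⊆? U) (λ s → drop-∷-⊆ s))) (∑-⊆ U))) ⟩
  ∑ (subsets n) (λ _ → 0) + (2 ^ ∣ U ∣ + 0)
    ≡⟨ cong₂ _+_ (trans (∑-const (subsets n) 0) (*-zeroʳ (length (subsets n)))) (+-identityʳ _) ⟩
  2 ^ ∣ U ∣ ∎
  where open ≤-Reasoning

-- If `W` is the set of points of colour `κ`, recolouring turns it into `W ∪ T`.
recolour : A → ∀ {n} → Subset n → Vec A n → Vec A n
recolour κ = zipWith (λ t a → if t then κ else a)

-- A colouring has at most length xs ^ ∣ T ∣ preimages under recolour κ T.
∑-recolour : (xs : List A) {κ : A} → κ ∈ xs → ∀ {n} (T : Subset n) (g : Vec A n → ℕ) →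
             ∑ (vecs xs n) (λ c → g (recolour κ T c)) ≤ length xs ^ ∣ T ∣ * ∑ (vecs xs n) g
∑-recolour xs κ∈ [] g = ≤-reflexive (sym (+-identityʳ _))
∑-recolour xs {κ} κ∈ {suc n} (false ∷ T) g = begin
  ∑ (vecs xs (suc n)) (λ c → g (recolour κ (false ∷ T) c))
    ≡⟨ ∑-vecs-suc xs n _ ⟩
  ∑ xs (λ a → ∑ (vecs xs n) (λ c → g (a ∷ recolour κ T c)))
    ≤⟨ ∑-mono xs (λ a → ∑-recolour xs κ∈ T (λ c → g (a ∷ c))) ⟩
  ∑ xs (λ a → length xs ^ ∣ T ∣ * ∑ (vecs xs n) (λ c → g (a ∷ c)))
    ≡⟨ ∑-*ˡ (length xs ^ ∣ T ∣) xs _ ⟩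
  length xs ^ ∣ T ∣ * ∑ xs (λ a → ∑ (vecs xs n) (λ c → g (a ∷ c)))
    ≡⟨ cong (length xs ^ ∣ T ∣ *_) (∑-vecs-suc xs n g) ⟨
  length xs ^ ∣ T ∣ * ∑ (vecs xs (suc n)) g ∎
  where open ≤-Reasoning
∑-recolour xs {κ} κ∈ {suc n} (true ∷ T) g = begin
  ∑ (vecs xs (suc n)) (λ c → g (recolour κ (true ∷ T) c))
    ≡⟨ ∑-vecs-suc xs n _ ⟩
  ∑ xs (λ a → ∑ (vecs xs n) (λ c → g (κ ∷ recolour κ T c)))
    -- On a point of `T` the old colour is forgotten: all `length xs` choices give the same value,
    -- and this value is one term, that of `κ`, of the full sum.
    ≡⟨ ∑-const xs _ ⟩
  length xs * ∑ (vecs xs n) (λ c → g (κ ∷ recolour κ T c))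
    ≤⟨ *-monoʳ-≤ (length xs) (∑-recolour xs κ∈ T (λ c → g (κ ∷ c))) ⟩
  length xs * (length xs ^ ∣ T ∣ * ∑ (vecs xs n) (λ c → g (κ ∷ c)))
    ≡⟨ *-assoc (length xs) _ _ ⟨
  length xs ^ suc ∣ T ∣ * ∑ (vecs xs n) (λ c → g (κ ∷ c))
    ≤⟨ *-monoʳ-≤ (length xs ^ suc ∣ T ∣) (∑-∈ (λ a → ∑ (vecs xs n) (λ c → g (a ∷ c))) κ∈) ⟩
  length xs ^ suc ∣ T ∣ * ∑ xs (λ a → ∑ (vecs xs n) (λ c → g (a ∷ c)))
    ≡⟨ cong (length xs ^ suc ∣ T ∣ *_) (∑-vecs-suc xs n g) ⟨
  length xs ^ suc ∣ T ∣ * ∑ (vecs xs (suc n)) g ∎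
  where open ≤-Reasoning

-- Minimal members and contained members of a list of sets

minBelow : ∀ {n} → List (Subset n) → Subset n → Subset n
minBelow []      T = T
minBelow (X ∷ V) T with X ⊆? minBelow V T
... | yes _ = X
... | no  _ = minBelow V T

minBelow-⊆ : ∀ {n} (V : List (Subset n)) (T : Subset n) → minBelow V T ⊆ T
minBelow-⊆ []      T = ⊆-refl
minBelow-⊆ (X ∷ V) T with X ⊆? minBelow V T
... | yes p = ⊆-trans p (minBelow-⊆ V T)
... | no  _ = minBelow-⊆ V T

minBelow-∈ : ∀ {n} (V : List (Subset n)) (T : Subset n) → minBelow V T ≡ T ⊎ minBelow V T ∈ V
minBelow-∈ []      T = inj₁ refl
minBelow-∈ (X ∷ V) T with X ⊆? minBelow V T
... | yes p = inj₂ (here refl)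
... | no  _ with minBelow-∈ V T
...   | inj₁ e = inj₁ e
...   | inj₂ i = inj₂ (there i)

-- If `X` replaces the result `Z` for the tail, then `X ⊆ Z`, and a member `Y ⊆ X` of the tail is
-- also below `Z`; minimality of `Z` gives `X ⊆ Z ⊆ Y`.
minBelow-min : ∀ {n} (V : List (Subset n)) (T : Subset n) {Y : Subset n} →
               Y ∈ V → Y ⊆ minBelow V T → minBelow V T ⊆ Y
minBelow-min (X ∷ V) T i s with X ⊆? minBelow V T
minBelow-min (X ∷ V) T (here refl) s | yes p = ⊆-refl
minBelow-min (X ∷ V) T (there i)   s | yes p = ⊆-trans p (minBelow-min V T i (⊆-trans s p))
minBelow-min (X ∷ V) T (here refl) s | no ¬p = ⊥-elim (¬p s)
minBelow-min (X ∷ V) T (there i)   s | no ¬p = minBelow-min V T i s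

-- The choice is a function of `V` and `W` alone, so it can be recovered after recolouring. The
-- default `⊥` respects every upper bound on sizes.
firstWithin : ∀ {n} → List (Subset n) → Subset n → Subset n
firstWithin []      W = ⊥
firstWithin (U ∷ V) W with U ⊆? W
... | yes _ = U
... | no  _ = firstWithin V W

firstWithin-∈ : ∀ {n} (V : List (Subset n)) (W : Subset n) → firstWithin V W ≡ ⊥ ⊎ firstWithin V W ∈ V
firstWithin-∈ []      W = inj₁ refl
firstWithin-∈ (U ∷ V) W with U ⊆? W
... | yes _ = inj₂ (here refl)
... | no  _ with firstWithin-∈ V W
...   | inj₁ e = inj₁ e
...   | inj₂ i = inj₂ (there i)

firstWithin-spec : ∀ {n} (V : List (Subset n)) (W : Subset n) {U : Subset n} → U ∈ V → U ⊆ W →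
                   firstWithin V W ∈ V × firstWithin V W ⊆ W
firstWithin-spec (X ∷ V) W i s with X ⊆? W
firstWithin-spec (X ∷ V) W i           s | yes p = here refl , p
firstWithin-spec (X ∷ V) W (here refl) s | no ¬p = ⊥-elim (¬p s)
firstWithin-spec (X ∷ V) W (there i)   s | no ¬p with firstWithin-spec V W i s
... | j , t = there j , t

-- Exposing the colours of one block

∈─⇒∉ : ∀ {n} (p q : Subset n) {x} → x ∈ˢ p ─ q → x ∉ˢ q
∈─⇒∉ (_ ∷ p) (false ∷ q) (there i) (there j) = ∈─⇒∉ p q i j
∈─⇒∉ (_ ∷ p) (true ∷ q)  (there i) (there j) = ∈─⇒∉ p q i j

𝟙-⊆ : ∀ {n} {T U : Subset n} → T ⊆ U → 𝟙 (T ⊆? U) ≡ 1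
𝟙-⊆ {T = T} {U} s = 𝟙-yes {P = T ⊆ U} s (T ⊆? U)

Colour : Set
Colour = ℕ × ℕ

_≟ᶜ_ : (a b : Colour) → Dec (a ≡ b)
_≟ᶜ_ = Product.≡-dec _≟_ _≟_

class : Colour → ∀ {n} → Vec Colour n → Subset n
class κ = Vec.map (λ a → does (a ≟ᶜ κ))

∈-class⁺ : ∀ κ {n} (c : Vec Colour n) {x} → lookup c x ≡ κ → x ∈ˢ class κ c
∈-class⁺ κ c {x} refl = lookup⇒[]= x _ (trans (lookup-map x _ c) h)
  where
  h : does (lookup c x ≟ᶜ lookup c x) ≡ true
  h with lookup c x ≟ᶜ lookup c x
  ... | yes _ = refl
  ... | no ¬p = ⊥-elim (¬p refl)

∈-class⁻ : ∀ κ {n} (c : Vec Colour n) {x} → x ∈ˢ class κ c → lookup c x ≡ κ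
∈-class⁻ κ c {x} i with lookup c x ≟ᶜ κ | trans (sym (lookup-map x (λ a → does (a ≟ᶜ κ)) c)) ([]=⇒lookup i)
... | yes e | _ = e

lookup-recolour-∈ : ∀ {A : Set} {κ : A} {n} {T : Subset n} (c : Vec A n) {x} → x ∈ˢ T → lookup (recolour κ T c) x ≡ κ
lookup-recolour-∈ {T = T} c {x} i = trans (lookup-zipWith _ x T c) (cong (if_then _ else _) ([]=⇒lookup i))

lookup-recolour-∉ : ∀ {A : Set} {κ : A} {n} {T : Subset n} (c : Vec A n) {x} → x ∉ˢ T → lookup (recolour κ T c) x ≡ lookup c x
lookup-recolour-∉ {T = T} c {x} x∉ = trans (lookup-zipWith _ x T c) (h (lookup T x) refl)
  where
  h : ∀ b → lookup T x ≡ b → (if b then _ else lookup c x) ≡ lookup c x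
  h true  e = ⊥-elim (x∉ (lookup⇒[]= x T e))
  h false e = refl

^-distribʳ-* : ∀ a b k → (a * b) ^ k ≡ a ^ k * b ^ k
^-distribʳ-* a b zero    = refl
^-distribʳ-* a b (suc k) rewrite ^-distribʳ-* a b k =
  solve 4 (λ a b c d → a :* b :* (c :* d) := a :* c :* (b :* d)) refl a b (a ^ k) (b ^ k)
  where open +-*-Solver

1+j≤2^j : ∀ j → suc j ≤ 2 ^ j
1+j≤2^j zero    = s≤s z≤n
1+j≤2^j (suc j) = begin
  suc (suc j)         ≡⟨ +-comm 1 (suc j) ⟩
  suc j + 1           ≤⟨ +-monoʳ-≤ (suc j) (s≤s z≤n) ⟩
  suc j + suc j       ≤⟨ +-mono-≤ (1+j≤2^j j) (1+j≤2^j j) ⟩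
  2 ^ j + 2 ^ j       ≡⟨ cong (2 ^ j +_) (+-identityʳ _) ⟨
  2 ^ suc j           ∎
  where open ≤-Reasoning

module Rounds {n : ℕ} (es : List Colour) (b L M : ℕ) (F : List (Subset n)) where

  -- `M` will be the length of `F`, so `Q` counts the pairs of a colouring and an original member;
  -- `r` is the spreadness constant.
  q r Q : ℕ
  q = length es
  r = 16 * q
  Q = q ^ n * M

  Colouring : Set
  Colouring = Vec Colour n

  Used : ℕ → Colour → Set
  Used j a = proj₁ a ≡ b × j ≤ proj₂ a × proj₂ a < L

  -- The state of block b when the colours (b , i) with j ≤ i < L have been exposed.
  record Stage (j : ℕ) : Set where
    field
      fam    : Colouring → List (Subset n)
      small  : ∀ c {U} → U ∈ fam c → ∣ U ∣ < 2 ^ j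
      spread : ∀ c T → ∑ (fam c) (λ U → 𝟙 (T ⊆? U)) * r ^ ∣ T ∣ ≤ M
      fresh  : ∀ c {U} → U ∈ fam c → ∀ {x} → x ∈ˢ U → ¬ Used j (lookup c x)
      -- The positions of the exposed colours determine the family: changes among unexposed colours
      -- leave it alone.
      stable : ∀ c c′ → (∀ x → Used j (lookup c x) ⊎ Used j (lookup c′ x) → lookup c x ≡ lookup c′ x) →
               fam c ≡ fam c′
      -- Once `U` is empty, this gives a member of `F` painted entirely in exposed colours of the
      -- block.
      cover  : ∀ c {U} → U ∈ fam c → ∃ λ S → S ∈ F × (∀ {x} → x ∈ˢ S → x ∈ˢ U ⊎ Used j (lookup c x))
      -- The total loss so far is at most `Q` divided by `3 * 4 ^ j`, the sum over all `i ≥ j` of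
      -- `Q` divided by `4 ^ suc i`.
      mass   : 3 * 4 ^ j * Q ≤ 3 * 4 ^ j * ∑ (vecs es n) (λ c → length (fam c)) + Q

  module Step (j : ℕ) (j<L : j < L) (κ∈ : (b , j) ∈ es) (St : Stage (suc j)) where
    open Stage St

    κ : Colour
    κ = b , j

    pieces : Colouring → List (Subset n)
    pieces c = map (_─ class κ c) (fam c)

    fragment : Colouring → Subset n → Subset n
    fragment c U = minBelow (pieces c) (U ─ class κ c)

    -- The default `U ─ class κ c` is itself a piece, so both outcomes of `minBelow` are pieces;
    -- `U′` may differ from `U`.
    fragment-piece : ∀ c {U} → U ∈ fam c → ∃ λ U′ → U′ ∈ fam c × fragment c U ≡ U′ ─ class κ c
    fragment-piece c {U} i with minBelow-∈ (pieces c) (U ─ class κ c)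
    ... | inj₁ e = U , i , e
    ... | inj₂ k = ∈-map⁻ (_─ class κ c) k

    fragment-⊆ : ∀ c U → fragment c U ⊆ U
    fragment-⊆ c U i = p─q⊆p U _ (minBelow-⊆ (pieces c) _ i)

    -- Evaluated at `recolour κ T c`, whose class of `κ` is `W ∪ T`, it is chosen without knowing
    -- how this union splits. Being small, it leaves few subsets as candidates for `T`.
    anchor : Colouring → Subset n
    anchor c = firstWithin (fam c) (class κ c)

    anchor-small : ∀ c → ∣ anchor c ∣ ≤ 2 ^ suc j
    anchor-small c with firstWithin-∈ (fam c) (class κ c)
    ... | inj₁ e = subst (_≤ 2 ^ suc j) (sym (trans (cong ∣_∣ e) (∣⊥∣≡0 n))) z≤n
    ... | inj₂ i = <⇒≤ (small c i)

    Used-suc : ∀ {a} → Used j a → a ≡ κ ⊎ Used (suc j) a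
    Used-suc {a , i} (refl , h , i<L) with m≤n⇒m<n∨m≡n h
    ... | inj₁ l    = inj₂ (refl , l , i<L)
    ... | inj₂ refl = inj₁ refl

    Used-κ : ∀ {a} → a ≡ κ → Used j a
    Used-κ refl = refl , ≤-refl , j<L

    Used-mono : ∀ {a} → Used (suc j) a → Used j a
    Used-mono (e , l , m) = e , <⇒≤ l , m

    ¬Used-κ : ¬ Used (suc j) κ
    ¬Used-κ (_ , h , _) = <-irrefl refl h

    -- Any member U₀ inside W ∪ T satisfies U₀ ─ W ⊆ T, and T is minimal, so T ⊆ U₀.
    fragment-⊆-anchor : ∀ c {U} → U ∈ fam c →
                        fragment c U ⊆ anchor (recolour κ (fragment c U) c)
    fragment-⊆-anchor c {U} U∈ {x} x∈T = p─q⊆p U₀ W (minBelow-min (pieces c) _ U₀─W∈ U₀─W⊆T x∈T)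
      where
      W T U₀ : Subset n
      T = fragment c U
      W = class κ c
      c′ = recolour κ T c
      U₀ = anchor c′

      -- Only points of `T` change: their old colours are unexposed by `fresh`, and the new colour
      -- `κ` is not exposed before this round.
      same : fam c ≡ fam c′
      same = stable c c′ agree
        where
        agree : ∀ x → Used (suc j) (lookup c x) ⊎ Used (suc j) (lookup c′ x) → lookup c x ≡ lookup c′ x
        agree x u with x ∈? T
        ... | no x∉ = sym (lookup-recolour-∉ c x∉)
        agree x (inj₁ u) | yes x∈ = ⊥-elim (fresh c U∈ (fragment-⊆ c U x∈) u)
        agree x (inj₂ u) | yes x∈ = ⊥-elim (¬Used-κ (subst (Used (suc j)) (lookup-recolour-∈ c x∈) u))

      U′ = proj₁ (fragment-piece c U∈)
      T≡ = proj₂ (proj₂ (fragment-piece c U∈))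

      -- Since `T` is `U′ ─ W`, the member `U′` lies inside `W ∪ T`; hence the anchor is a genuine
      -- member and not the default `⊥`.
      U′⊆ : U′ ⊆ class κ c′
      U′⊆ {y} y∈ with y ∈? T
      ... | yes y∈T = ∈-class⁺ κ c′ (lookup-recolour-∈ c y∈T)
      ... | no y∉T with y ∈? W
      ...   | yes y∈W = ∈-class⁺ κ c′ (trans (lookup-recolour-∉ c y∉T) (∈-class⁻ κ c y∈W))
      ...   | no y∉W  = ⊥-elim (y∉T (subst (y ∈ˢ_) (sym T≡) (x∈p∧x∉q⇒x∈p─q y∈ y∉W)))

      found = firstWithin-spec (fam c′) (class κ c′)
                (subst (U′ ∈_) same (proj₁ (proj₂ (fragment-piece c U∈)))) U′⊆

      U₀─W∈ : U₀ ─ W ∈ pieces c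
      U₀─W∈ = ∈-map⁺ (_─ W) (subst (U₀ ∈_) (sym same) (proj₁ found))

      U₀─W⊆T : U₀ ─ W ⊆ T
      U₀─W⊆T {y} y∈ with y ∈? T
      ... | yes y∈T = y∈T
      ... | no y∉T  = ⊥-elim (∈─⇒∉ U₀ W y∈ (∈-class⁺ κ c
                        (trans (sym (lookup-recolour-∉ c y∉T)) (∈-class⁻ κ c′ (proj₂ found (p─q⊆p U₀ W y∈))))))

    h : ℕ
    h = 2 ^ j

    lost : Colouring → ℕ
    lost c = ∑ (fam c) (λ U → 𝟙 (h ≤? ∣ fragment c U ∣))

    large : Subset n → ℕ
    large T = 𝟙 (h ≤? ∣ T ∣)

    anchored : Subset n → Colouring → ℕ
    anchored T c = 𝟙 (T ⊆? anchor c)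

    degree : Colouring → Subset n → ℕ
    degree c T = ∑ (fam c) (λ U → 𝟙 (T ⊆? U))

    -- Each large fragment is charged to itself as a set `T`, for which both indicators are 1. The
    -- right side no longer mentions `fragment`, so `T` can be fixed first and the colourings summed
    -- afterwards.
    lost-≤ : ∀ c → lost c ≤ ∑ (subsets n) (λ T → large T * (anchored T (recolour κ T c) * degree c T))
    lost-≤ c = begin
      lost c
        ≤⟨ ∑-mono-∈ (fam c) (λ {U} U∈ → begin
             large (fragment c U)
               ≡⟨ trans (cong₂ (λ u v → large (fragment c U) * (u * v))
                    (𝟙-⊆ (fragment-⊆-anchor c U∈)) (𝟙-⊆ (fragment-⊆ c U)))
                    (*-identityʳ _) ⟨
             large (fragment c U) * (anchored (fragment c U) (recolour κ (fragment c U) c) * 𝟙 (fragment c U ⊆? U))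
               ≤⟨ ∑-∈ (λ T → large T * (anchored T (recolour κ T c) * 𝟙 (T ⊆? U))) (∈-subsets (fragment c U)) ⟩
             ∑ (subsets n) (λ T → large T * (anchored T (recolour κ T c) * 𝟙 (T ⊆? U))) ∎) ⟩
      ∑ (fam c) (λ U → ∑ (subsets n) (λ T → large T * (anchored T (recolour κ T c) * 𝟙 (T ⊆? U))))
        ≡⟨ ∑-swap (fam c) (subsets n) _ ⟩
      ∑ (subsets n) (λ T → ∑ (fam c) (λ U → large T * (anchored T (recolour κ T c) * 𝟙 (T ⊆? U))))
        ≡⟨ ∑-cong (subsets n) (λ T → trans (∑-*ˡ (large T) (fam c) _)
             (cong (large T *_) (∑-*ˡ (anchored T (recolour κ T c)) (fam c) _))) ⟩
      ∑ (subsets n) (λ T → large T * (anchored T (recolour κ T c) * degree c T)) ∎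
      where open ≤-Reasoning

    Cs : List Colouring
    Cs = vecs es n

    instance
      q≢0 : NonZero q
      q≢0 = >-nonZero (∈-length κ∈)

    -- Recolouring costs q ^ ∣ T ∣, spreadness gains (16 q) ^ ∣ T ∣.
    fragment-count : ∀ T → 16 ^ ∣ T ∣ * ∑ Cs (λ c → anchored T (recolour κ T c) * degree c T) ≤
                           M * ∑ Cs (anchored T)
    fragment-count T = *-cancelˡ-≤ (q ^ t) {{m^n≢0 q t}} (begin
      q ^ t * (16 ^ t * ∑ Cs (λ c → anchored T (recolour κ T c) * degree c T))
        ≡⟨ trans (sym (*-assoc (q ^ t) (16 ^ t) _)) (cong (_* ∑ Cs (λ c → anchored T (recolour κ T c) * degree c T))
             (trans (*-comm (q ^ t) (16 ^ t)) (sym (^-distribʳ-* 16 q t)))) ⟩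
      r ^ t * ∑ Cs (λ c → anchored T (recolour κ T c) * degree c T)
        ≡⟨ ∑-*ˡ (r ^ t) Cs _ ⟨
      ∑ Cs (λ c → r ^ t * (anchored T (recolour κ T c) * degree c T))
        ≤⟨ ∑-mono Cs (λ c → ≤-trans (≤-reflexive (rearrange (r ^ t) (anchored T (recolour κ T c)) (degree c T)))
                                    (*-monoˡ-≤ (anchored T (recolour κ T c)) (spread c T))) ⟩
      ∑ Cs (λ c → M * anchored T (recolour κ T c))
        ≡⟨ ∑-*ˡ M Cs _ ⟩
      M * ∑ Cs (λ c → anchored T (recolour κ T c))
        ≤⟨ *-monoʳ-≤ M (∑-recolour es κ∈ T (anchored T)) ⟩
      M * (q ^ t * ∑ Cs (anchored T))
        ≡⟨ solve 3 (λ m a s → m :* (a :* s) := a :* (m :* s)) refl M (q ^ t) (∑ Cs (anchored T)) ⟩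
      q ^ t * (M * ∑ Cs (anchored T)) ∎)
      where
      open ≤-Reasoning
      open +-*-Solver
      t = ∣ T ∣
      rearrange : ∀ a b c → a * (b * c) ≡ c * a * b
      rearrange = solve 3 (λ a b c → a :* (b :* c) := c :* a :* b) refl

    large-fragment-count : ∀ T → 16 ^ h * (large T * ∑ Cs (λ c → anchored T (recolour κ T c) * degree c T)) ≤
                                 M * ∑ Cs (anchored T)
    large-fragment-count T with h ≤? ∣ T ∣
    ... | no _  = ≤-trans (≤-reflexive (*-zeroʳ (16 ^ h))) z≤n
    ... | yes p = ≤-trans (*-mono-≤ (^-monoʳ-≤ 16 p) (≤-reflexive (*-identityˡ _))) (fragment-count T)

    -- This is why the spreadness constant contains 16: of `16 ^ h = 4 ^ h * 4 ^ h`, one factor pays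
    -- for the at most `2 ^ (2 * h)` subsets of an anchor, and the other is the gain, at least
    -- `4 ^ suc j` because `h = 2 ^ j ≥ suc j`.
    lost-bound : 4 ^ suc j * ∑ Cs lost ≤ Q
    lost-bound = ≤-trans (*-monoˡ-≤ _ (^-monoʳ-≤ 4 (1+j≤2^j j))) (*-cancelˡ-≤ (4 ^ h) {{m^n≢0 4 h}} (begin
      4 ^ h * (4 ^ h * ∑ Cs lost)
        ≡⟨ trans (sym (*-assoc (4 ^ h) (4 ^ h) _)) (cong (_* ∑ Cs lost) (sym (^-distribʳ-* 4 4 h))) ⟩
      16 ^ h * ∑ Cs lost
        ≤⟨ *-monoʳ-≤ (16 ^ h) (∑-mono Cs lost-≤) ⟩
      16 ^ h * ∑ Cs (λ c → ∑ (subsets n) (λ T → large T * (anchored T (recolour κ T c) * degree c T)))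
        ≡⟨ cong (16 ^ h *_) (trans (∑-swap Cs (subsets n) _) (∑-cong (subsets n) (λ T → ∑-*ˡ (large T) Cs _))) ⟩
      16 ^ h * ∑ (subsets n) (λ T → large T * ∑ Cs (λ c → anchored T (recolour κ T c) * degree c T))
        ≡⟨ ∑-*ˡ (16 ^ h) (subsets n) _ ⟨
      ∑ (subsets n) (λ T → 16 ^ h * (large T * ∑ Cs (λ c → anchored T (recolour κ T c) * degree c T)))
        ≤⟨ ∑-mono (subsets n) large-fragment-count ⟩
      ∑ (subsets n) (λ T → M * ∑ Cs (anchored T))
        ≡⟨ trans (∑-*ˡ M (subsets n) _) (cong (M *_) (∑-swap (subsets n) Cs _)) ⟩
      M * ∑ Cs (λ c → ∑ (subsets n) (λ T → anchored T c))
        ≤⟨ *-monoʳ-≤ M (∑-mono Cs (λ c → ≤-trans (∑-⊆ (anchor c)) (^-monoʳ-≤ 2 (anchor-small c)))) ⟩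
      M * ∑ Cs (λ _ → 2 ^ 2 ^ suc j)
        ≡⟨ cong (M *_) (trans (∑-const Cs _) (cong₂ _*_ (length-vecs es n) (sym (^-*-assoc 2 2 h)))) ⟩
      M * (q ^ n * 4 ^ h)
        ≡⟨ solve 3 (λ m a s → m :* (a :* s) := s :* (a :* m)) refl M (q ^ n) (4 ^ h) ⟩
      4 ^ h * Q ∎))
      where
      open ≤-Reasoning
      open +-*-Solver

    small? : Decidable (λ (T : Subset n) → ∣ T ∣ < h)
    small? T = ∣ T ∣ <? h

    fam′ : Colouring → List (Subset n)
    fam′ c = filter small? (map (fragment c) (fam c))

    fam′-∈ : ∀ c {T} → T ∈ fam′ c → ∃ λ U → U ∈ fam c × T ≡ fragment c U
    fam′-∈ c i = ∈-map⁻ (fragment c) (proj₁ (∈-filter⁻ small? i))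

    length-fam : ∀ c → length (fam c) ≤ length (fam′ c) + lost c
    length-fam c = subst₂ (λ u v → u ≤ length (fam′ c) + v)
      (length-map (fragment c) (fam c)) (∑-map (fragment c) (fam c) _)
      (length-filter+∑ small? (λ T → h ≤? ∣ T ∣) (λ _ → ≮⇒≥) (map (fragment c) (fam c)))

    -- One step of the geometric series: in units of `Q`, the old loss `1 / (3 * 4 ^ suc j)` and the
    -- new loss `1 / 4 ^ suc j` add up to `1 / (3 * 4 ^ j)`.
    mass′ : 3 * 4 ^ j * Q ≤ 3 * 4 ^ j * ∑ Cs (λ c → length (fam′ c)) + Q
    mass′ = *-cancelˡ-≤ 4 (begin
      4 * (3 * 4 ^ j * Q)
        ≡⟨ solve 2 (λ a z → con 4 :* (con 3 :* a :* z) := con 3 :* (con 4 :* a) :* z) refl (4 ^ j) Q ⟩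
      3 * 4 ^ suc j * Q
        ≤⟨ mass ⟩
      3 * 4 ^ suc j * ∑ Cs (λ c → length (fam c)) + Q
        ≤⟨ +-monoˡ-≤ Q (*-monoʳ-≤ (3 * 4 ^ suc j) (≤-trans (∑-mono Cs length-fam) (≤-reflexive (∑-+ Cs _ lost)))) ⟩
      3 * 4 ^ suc j * (Y + X) + Q
        ≡⟨ solve 4 (λ a y x z → con 3 :* a :* (y :+ x) :+ z := con 3 :* a :* y :+ con 3 :* (a :* x) :+ z) refl (4 ^ suc j) Y X Q ⟩
      3 * 4 ^ suc j * Y + 3 * (4 ^ suc j * X) + Q
        ≤⟨ +-monoˡ-≤ Q (+-monoʳ-≤ (3 * 4 ^ suc j * Y) (*-monoʳ-≤ 3 lost-bound)) ⟩
      3 * 4 ^ suc j * Y + 3 * Q + Q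
        ≡⟨ solve 3 (λ a y z → con 3 :* (con 4 :* a) :* y :+ con 3 :* z :+ z := con 4 :* (con 3 :* a :* y :+ z)) refl (4 ^ j) Y Q ⟩
      4 * (3 * 4 ^ j * Y + Q) ∎)
      where
      open ≤-Reasoning
      open +-*-Solver
      X = ∑ Cs lost
      Y = ∑ Cs (λ c → length (fam′ c))

    stage : Stage j
    stage = record
      { fam    = fam′
      ; small  = λ c i → proj₂ (∈-filter⁻ small? {xs = map (fragment c) (fam c)} i)
      ; spread = λ c T → ≤-trans (*-monoˡ-≤ (r ^ ∣ T ∣) (degree-≤ c T)) (spread c T)
      ; fresh  = fresh′
      ; stable = stable′
      ; cover  = cover′
      ; mass   = mass′
      }
      where
      degree-≤ : ∀ c T → ∑ (fam′ c) (λ U → 𝟙 (T ⊆? U)) ≤ degree c T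
      degree-≤ c T = ≤-trans (∑-filter-≤ small? (map (fragment c) (fam c)) _)
        (≤-trans (≤-reflexive (∑-map (fragment c) (fam c) _))
          (∑-mono (fam c) (λ U → 𝟙-mono (T ⊆? fragment c U) (T ⊆? U) (λ s i → fragment-⊆ c U (s i)))))

      fresh′ : ∀ c {T} → T ∈ fam′ c → ∀ {x} → x ∈ˢ T → ¬ Used j (lookup c x)
      fresh′ c i x∈ u with fam′-∈ c i
      ... | U , U∈ , refl with Used-suc u
      ...   | inj₂ u′ = fresh c U∈ (fragment-⊆ c U x∈) u′
      ...   | inj₁ e  = ∈─⇒∉ U _ (minBelow-⊆ (pieces c) _ x∈) (∈-class⁺ κ c e)

      stable′ : ∀ c c′ → (∀ x → Used j (lookup c x) ⊎ Used j (lookup c′ x) → lookup c x ≡ lookup c′ x) →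
                fam′ c ≡ fam′ c′
      -- `fam′` is built from `fam` and the class of `κ` only, and agreement on the colours used
      -- from level `j` on fixes both.
      stable′ c c′ agree = cong₂ (λ V W → filter small? (map (λ U → minBelow (map (_─ W) V) (U ─ W)) V))
        (stable c c′ λ x → agree x ∘ Sum.map Used-mono Used-mono)
        (⊆-antisym
          (λ {x} i → let e = ∈-class⁻ κ c i in
            ∈-class⁺ κ c′ (trans (sym (agree x (inj₁ (Used-κ e)))) e))
          (λ {x} i → let e = ∈-class⁻ κ c′ i in
            ∈-class⁺ κ c (trans (agree x (inj₂ (Used-κ e))) e)))

      cover′ : ∀ c {T} → T ∈ fam′ c → ∃ λ S → S ∈ F × (∀ {x} → x ∈ˢ S → x ∈ˢ T ⊎ Used j (lookup c x))
      cover′ c i with fam′-∈ c i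
      -- The original member is the one behind `U′`, not behind `U`; the points that `U′` loses have
      -- colour `κ`, which now counts as exposed.
      ... | U , U∈ , refl with fragment-piece c U∈
      ...   | U′ , U′∈ , e with cover c U′∈
      ...     | S , S∈ , f = S , S∈ , g
        where
        g : ∀ {x} → x ∈ˢ S → x ∈ˢ fragment c U ⊎ Used j (lookup c x)
        g {x} x∈ with f x∈
        ... | inj₂ u = inj₂ (Used-mono u)
        ... | inj₁ x∈U′ with x ∈? class κ c
        ...   | yes k = inj₂ (Used-κ (∈-class⁻ κ c k))
        ...   | no ¬k = inj₁ (subst (x ∈ˢ_) (sym e) (x∈p∧x∉q⇒x∈p─q x∈U′ ¬k))

  descend : (∀ {i} → i < L → (b , i) ∈ es) → ∀ j → j ≤ L → Stage j → Stage 0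
  descend κ∈ zero    _ St = St
  descend κ∈ (suc j) l St = descend κ∈ j (<⇒≤ l) (Step.stage j l (κ∈ l) St)

-- Disjoint members of a spread family

Disjoint : ∀ {n} → Subset n → Subset n → Set
Disjoint A B = ∀ {x} → x ∈ˢ A → x ∉ˢ B

-- The last component strengthens the induction: knowing the parts that hold the sets chosen so far
-- is what makes the next set disjoint from them.
disjointSelection : ∀ {I : Set} {n} {F : List (Subset n)} {Part : I → Fin n → Set} →
  (∀ {a b x} → Part a x → Part b x → a ≡ b) → ∀ {bs} → Unique bs →
  All (λ b → ∃ λ S → S ∈ F × (∀ {x} → x ∈ˢ S → Part b x)) bs →
  ∃ λ Ss → length Ss ≡ length bs × All (_∈ F) Ss × AllPairs Disjoint Ss ×
           All (λ S → ∃ λ b → b ∈ bs × (∀ {x} → x ∈ˢ S → Part b x)) Ss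
disjointSelection {Part = Part} inj [] [] = [] , refl , [] , [] , []
disjointSelection {F = F} {Part} inj {b ∷ _} (b∉ ∷ u) ((S , S∈F , S⊆) ∷ ps) with disjointSelection {F = F} {Part} inj u ps
... | Ss , len , Ss∈F , dis , parts =
  S ∷ Ss , cong suc len , S∈F ∷ Ss∈F , All.map separate parts ∷ dis ,
  (b , here refl , S⊆) ∷ All.map (λ (b′ , i , f) → b′ , there i , λ {x} → f {x}) parts
  where
  separate : ∀ {S′} → (∃ λ b′ → b′ ∈ _ × (∀ {x} → x ∈ˢ S′ → Part b′ x)) → Disjoint S S′
  separate (b′ , i , f) x∈S x∈S′ = All.lookup b∉ i (inj (S⊆ x∈S) (f x∈S′))

∈⇒0<∣∣ : ∀ {n} {p : Subset n} {x} → x ∈ˢ p → 0 < ∣ p ∣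
∈⇒0<∣∣ x∈ = ≤-<-trans z≤n (x∈p⇒∣p-x∣<∣p∣ x∈)

module _ {n : ℕ} (F : List (Subset n)) (p L : ℕ) (0<p : 0 < p) (0<L : 0 < L) (0<M : 0 < length F) where

  private
    M q : ℕ
    M = length F
    q = 2 * p * L

    es : List Colour
    es = cartesianProduct (upTo (2 * p)) (upTo L)

    length-es : length es ≡ q
    length-es = trans (length-cartesianProductWith _,_ (upTo (2 * p)) (upTo L)) (cong₂ _*_ (length-upTo (2 * p)) (length-upTo L))

    blocks : List (Fin (2 * p))
    blocks = allFin (2 * p)

    Cs : List (Vec Colour n)
    Cs = vecs es n

    module R b = Rounds {n} es b L M F

    regroup : length Cs * (4 * p * M) ≡ 2 * p * (2 * (length es ^ n * M))
    regroup rewrite length-vecs es n = solve 3 (λ a p m → a :* (con 4 :* p :* m) := con 2 :* p :* (con 2 :* (a :* m))) refl (length es ^ n) p M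
      where open +-*-Solver

  -- On average each of the `2 * p` blocks keeps at least 2/3 of the `M` members, so some colouring
  -- keeps at least `4 * p * M / 3` in all. No block keeps more than `M`, so at least `4 * p / 3`,
  -- hence at least `p`, blocks keep something.
  spread⇒disjoint : (∀ {U} → U ∈ F → ∣ U ∣ < 2 ^ L) →
                    (∀ T → ∑ F (λ U → 𝟙 (T ⊆? U)) * (16 * q) ^ ∣ T ∣ ≤ M) →
                    ∃ λ Ss → length Ss ≡ p × All (_∈ F) Ss × AllPairs Disjoint Ss
  spread⇒disjoint small spread = finish Cs refl
    where
    start : ∀ b → R.Stage b L
    start b = record
      { fam    = λ _ → F
      ; small  = λ _ → small
      ; spread = λ c T → subst (λ z → ∑ F (λ U → 𝟙 (T ⊆? U)) * (16 * z) ^ ∣ T ∣ ≤ M) (sym length-es) (spread T)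
      -- At the start nothing is exposed: no level is both at least `L` and below `L`.
      ; fresh  = λ { c _ _ (_ , l , m) → <⇒≱ m l }
      ; stable = λ _ _ _ → refl
      ; cover  = λ c {U} U∈ → U , U∈ , inj₁
      ; mass   = ≤-trans (≤-reflexive (cong (3 * 4 ^ L *_) (sym (trans (∑-const (vecs es n) M) (cong (_* M) (length-vecs es n))))))
                         (m≤m+n _ _)
      }

    final : (b : Fin (2 * p)) → R.Stage (toℕ b) 0
    final b = R.descend (toℕ b) (λ l → ∈-cartesianProduct⁺ (∈-upTo⁺ (toℕ<n b)) (∈-upTo⁺ l)) L ≤-refl (start (toℕ b))

    fam : Fin (2 * p) → Vec Colour n → List (Subset n)
    fam b = R.Stage.fam (final b)

    survivors : Vec Colour n → Fin (2 * p) → ℕ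
    survivors c b = length (fam b c)

    -- Spreadness at the empty set, which every member contains.
    survivors-≤ : ∀ c b → survivors c b ≤ M
    survivors-≤ c b = begin
      length (fam b c)                                   ≡⟨ trans (∑-const (fam b c) 1) (*-identityʳ _) ⟨
      ∑ (fam b c) (λ _ → 1)                              ≡⟨ ∑-cong (fam b c) (λ U → sym (𝟙-⊆ {T = ⊥} {U} ⊥⊆)) ⟩
      ∑ (fam b c) (λ U → 𝟙 (⊥ ⊆? U))                     ≡⟨ *-identityʳ _ ⟨
      ∑ (fam b c) (λ U → 𝟙 (⊥ ⊆? U)) * 1
        ≡⟨ cong (λ z → ∑ (fam b c) (λ U → 𝟙 (⊥ ⊆? U)) * (16 * length es) ^ z) (∣⊥∣≡0 n) ⟨
      ∑ (fam b c) (λ U → 𝟙 (⊥ ⊆? U)) * (16 * length es) ^ ∣ ⊥ {n} ∣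
        ≤⟨ R.Stage.spread (final b) c ⊥ ⟩
      M ∎
      where open ≤-Reasoning

    -- The mass bound at level 0 reads `3 * Q ≤ 3 * S + Q`, with `S` the total number of survivors.
    many-survive : ∀ b → 2 * (length es ^ n * M) ≤ 3 * ∑ Cs (λ c → survivors c b)
    many-survive b = +-cancelʳ-≤ (length es ^ n * M) _ _
      (subst (_≤ 3 * ∑ Cs (λ c → survivors c b) + length es ^ n * M)
        (solve 1 (λ z → con 3 :* con 1 :* z := con 2 :* z :+ z) refl (length es ^ n * M))
        (R.Stage.mass (final b)))
      where open +-*-Solver

    average : length Cs * (4 * p * M) ≤ ∑ Cs (λ c → 3 * ∑ blocks (survivors c))
    average = begin
      length Cs * (4 * p * M)
        ≡⟨ regroup ⟩
      2 * p * (2 * (length es ^ n * M))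
        ≡⟨ trans (∑-const blocks _) (cong (_* (2 * (length es ^ n * M))) (length-tabulate {n = 2 * p} (λ i → i))) ⟨
      ∑ blocks (λ _ → 2 * (length es ^ n * M))
        ≤⟨ ∑-mono blocks many-survive ⟩
      ∑ blocks (λ b → 3 * ∑ Cs (λ c → survivors c b))
        ≡⟨ ∑-*ˡ 3 blocks _ ⟩
      3 * ∑ blocks (λ b → ∑ Cs (λ c → survivors c b))
        ≡⟨ cong (3 *_) (∑-swap blocks Cs (λ b c → survivors c b)) ⟩
      3 * ∑ Cs (λ c → ∑ blocks (survivors c))
        ≡⟨ ∑-*ˡ 3 Cs _ ⟨
      ∑ Cs (λ c → 3 * ∑ blocks (survivors c)) ∎
      where open ≤-Reasoning

    module _ (c : Vec Colour n) (dense : 4 * p * M ≤ 3 * ∑ blocks (survivors c)) where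

      good? : Decidable (λ b → 0 < survivors c b)
      good? b = 0 <? survivors c b

      goods : List (Fin (2 * p))
      goods = filter good? blocks

      survivors-good : ∀ b → survivors c b ≤ M * 𝟙 (good? b)
      survivors-good b with good? b
      ... | yes _ = ≤-trans (survivors-≤ c b) (≤-reflexive (sym (*-identityʳ M)))
      ... | no ¬g = ≤-trans (≮⇒≥ ¬g) z≤n

      p≤goods : p ≤ length goods
      p≤goods = *-cancelˡ-≤ 3 (*-cancelˡ-≤ M {{>-nonZero 0<M}} (begin
        M * (3 * p)                              ≤⟨ *-monoʳ-≤ M (*-monoˡ-≤ p (n≤1+n 3)) ⟩
        M * (4 * p)                              ≡⟨ *-comm M (4 * p) ⟩
        4 * p * M                                ≤⟨ dense ⟩
        3 * ∑ blocks (survivors c)               ≤⟨ *-monoʳ-≤ 3 (∑-mono blocks survivors-good) ⟩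
        3 * ∑ blocks (λ b → M * 𝟙 (good? b))     ≡⟨ cong (3 *_) (trans (∑-*ˡ M blocks _) (cong (M *_) (∑-𝟙 good? blocks))) ⟩
        3 * (M * length goods)                   ≡⟨ solve 2 (λ m g → con 3 :* (m :* g) := m :* (con 3 :* g)) refl M (length goods) ⟩
        M * (3 * length goods)                   ∎))
        where
        open ≤-Reasoning
        open +-*-Solver

      -- A survivor has fewer than `2 ^ 0` points, so it is empty, and `cover` then places a whole
      -- member of `F` in block `b`.
      member : ∀ {b} → 0 < survivors c b → ∃ λ S → S ∈ F × (∀ {x} → x ∈ˢ S → proj₁ (lookup c x) ≡ toℕ b)
      member {b} g with fam b c in eq
      member {b} () | []
      member {b} g  | U ∷ _ with R.Stage.cover (final b) c (subst (U ∈_) (sym eq) (here refl))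
      ... | S , S∈ , S⊆ = S , S∈ , λ x∈ → case S⊆ x∈ of λ
        { (inj₁ x∈U) → ⊥-elim (<⇒≱ (∈⇒0<∣∣ x∈U) (s≤s⁻¹ (R.Stage.small (final b) c (subst (U ∈_) (sym eq) (here refl)))))
        ; (inj₂ u)   → proj₁ u }

      select : ∃ λ Ss → length Ss ≡ p × All (_∈ F) Ss × AllPairs Disjoint Ss
      select with disjointSelection {F = F} {λ b x → proj₁ (lookup c x) ≡ toℕ b}
                    (λ e e′ → toℕ-injective (trans (sym e) e′))
                    (Unique.take⁺ p (Unique.filter⁺ good? (Unique.allFin⁺ (2 * p))))
                    (All.map member (All.take⁺ p (All.all-filter good? blocks)))
      ... | Ss , len , Ss∈ , dis , _ =
        Ss , trans len (trans (length-take p goods) (m≤n⇒m⊓n≡m p≤goods)) , Ss∈ , dis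

    -- The enumeration is split to give the pigeonhole a head; it cannot be empty, as there are
    -- `q ^ n > 0` colourings.
    finish : ∀ cs → cs ≡ Cs → ∃ λ Ss → length Ss ≡ p × All (_∈ F) Ss × AllPairs Disjoint Ss
    finish []       e = ⊥-elim (<⇒≱ nonempty (≤-reflexive (sym (cong length e))))
      where
      nonempty : 0 < length Cs
      nonempty = subst (0 <_) (sym (length-vecs es n)) (subst (λ z → 0 < z ^ n) (sym length-es)
        (>-nonZero⁻¹ (q ^ n) {{m^n≢0 q n {{m*n≢0 (2 * p) L {{m*n≢0 2 p {{_}} {{>-nonZero 0<p}}}} {{>-nonZero 0<L}}}}}}))
    finish (c ∷ cs) e with ∑-pigeonhole c cs (λ c → 3 * ∑ blocks (survivors c))
                             (subst (λ z → length z * (4 * p * M) ≤ ∑ z (λ c → 3 * ∑ blocks (survivors c))) (sym e) average)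
    ... | c′ , dense = select c′ dense

-- Sunflowers in large families

∣∪∣-disjoint : ∀ {n} (p q : Subset n) → Disjoint p q → ∣ p ∣ + ∣ q ∣ ≡ ∣ p ∪ q ∣
∣∪∣-disjoint []          []          d = refl
∣∪∣-disjoint (true ∷ p)  (true ∷ q)  d = ⊥-elim (d here here)
∣∪∣-disjoint (true ∷ p)  (false ∷ q) d = cong suc (∣∪∣-disjoint p q (λ i j → d (there i) (there j)))
∣∪∣-disjoint (false ∷ p) (true ∷ q)  d = trans (+-suc ∣ p ∣ ∣ q ∣) (cong suc (∣∪∣-disjoint p q (λ i j → d (there i) (there j))))
∣∪∣-disjoint (false ∷ p) (false ∷ q) d = ∣∪∣-disjoint p q (λ i j → d (there i) (there j))

⊆∧∣∣≡⇒≡ : ∀ {n} {p q : Subset n} → p ⊆ q → ∣ p ∣ ≡ ∣ q ∣ → p ≡ q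
⊆∧∣∣≡⇒≡ {p = p} {q} s e with p ⊂? q
... | yes p⊂q = ⊥-elim (<-irrefl e (p⊂q⇒∣p∣<∣q∣ p⊂q))
... | no ¬p⊂q = ⊆-antisym s λ {x} x∈q → case x ∈? p of λ
  { (yes x∈p) → x∈p
  ; (no x∉p)  → ⊥-elim (¬p⊂q (s , x , x∈q , x∉p)) }

─-∪-cancel : ∀ {n} {A S : Subset n} → A ⊆ S → (S ─ A) ∪ A ≡ S
─-∪-cancel {A = A} {S} s = ⊆-antisym
  (λ i → case x∈p∪q⁻ (S ─ A) A i of λ { (inj₁ j) → p─q⊆p S A j ; (inj₂ j) → s j })
  (λ {x} i → x∈p∪q⁺ (case x ∈? A of λ { (yes j) → inj₂ j ; (no j) → inj₁ (x∈p∧x∉q⇒x∈p─q i j) }))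

AllPairs-lookup : ∀ {A : Set} {R : A → A → Set} → Symmetric R → ∀ {xs x y} →
                  AllPairs R xs → x ∈ xs → y ∈ xs → x ≡ y ⊎ R x y
AllPairs-lookup s (r ∷ rs) (here refl) (here refl) = inj₁ refl
AllPairs-lookup s (r ∷ rs) (here refl) (there j)   = inj₂ (All.lookup r j)
AllPairs-lookup s (r ∷ rs) (there i)   (here refl) = inj₂ (s (All.lookup r i))
AllPairs-lookup s (r ∷ rs) (there i)   (there j)   = AllPairs-lookup s rs i j

AllPairs-∈ : ∀ {A : Set} {R S : A → A → Set} {xs} → (∀ {x y} → x ∈ xs → y ∈ xs → R x y → S x y) →
             AllPairs R xs → AllPairs S xs
AllPairs-∈ h []       = []
AllPairs-∈ h (r ∷ rs) = All.tabulate (λ i → h (here refl) (there i) (All.lookup r i)) ∷ AllPairs-∈ (λ i j → h (there i) (there j)) rs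

Unique-constant : ∀ {A : Set} {a : A} {xs} → Unique xs → (∀ {x} → x ∈ xs → x ≡ a) → length xs ≤ 1
Unique-constant []                h = z≤n
Unique-constant (_ ∷ [])          h = s≤s z≤n
Unique-constant ((x≢y ∷ _) ∷ _ ∷ _) h = ⊥-elim (x≢y (trans (h (here refl)) (sym (h (there (here refl))))))

module _ {n : ℕ} (F : List (Subset n)) (k p L : ℕ) (F! : Unique F) (F-size : All (λ A → ∣ A ∣ ≡ k) F)
         (0<p : 0 < p) (0<L : 0 < L) (k<2^L : k < 2 ^ L) where

  private
    R : ℕ
    R = 16 * (2 * p * L)

    instance
      R≢0 : NonZero R
      R≢0 = m*n≢0 16 (2 * p * L) {{_}} {{m*n≢0 (2 * p) L {{m*n≢0 2 p {{_}} {{>-nonZero 0<p}}}} {{>-nonZero 0<L}}}}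

    star : Subset n → List (Subset n)
    star A = filter (A ⊆?_) F

    -- Says that more than `R ^ (k - ∣ A ∣)` members contain `A`, written without subtraction.
    Heavy : Subset n → Set
    Heavy A = R ^ k < length (star A) * R ^ ∣ A ∣

    -- Climbs to a strictly larger heavy set as long as there is one. The fuel `f` bounds the number
    -- of points still outside `A`.
    maximalHeavy : ∀ f A → n ≤ ∣ A ∣ + f → Heavy A → ∃ λ A′ → Heavy A′ × (∀ {B} → A′ ⊂ B → ¬ Heavy B)
    maximalHeavy f A l H with anySubset? (λ B → (A ⊂? B) ×-dec (R ^ k <? length (star B) * R ^ ∣ B ∣))
    ... | no ¬∃ = A , H , λ A⊂B H′ → ¬∃ (_ , A⊂B , H′)
    maximalHeavy zero A l H | yes (B , A⊂B , _) =
      ⊥-elim (<⇒≱ (p⊂q⇒∣p∣<∣q∣ A⊂B) (≤-trans (∣p∣≤n B) (subst (n ≤_) (+-identityʳ _) l)))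
    maximalHeavy (suc f) A l H | yes (B , A⊂B , H′) =
      maximalHeavy f B (≤-trans l (≤-trans (≤-reflexive (+-suc ∣ A ∣ f)) (+-monoˡ-≤ f (p⊂q⇒∣p∣<∣q∣ A⊂B)))) H′

  module Kernel (A : Subset n) (heavy : Heavy A) (maximal : ∀ {B} → A ⊂ B → ¬ Heavy B) where

    link : List (Subset n)
    link = map (_─ A) (star A)

    ∈-star : ∀ {S} → S ∈ star A → S ∈ F × A ⊆ S
    ∈-star i = ∈-filter⁻ (A ⊆?_) i

    0<link : 0 < length link
    0<link = subst (0 <_) (sym (length-map (_─ A) (star A)))
      (n≢0⇒n>0 λ e → case subst (λ z → R ^ k < z * R ^ ∣ A ∣) e heavy of λ ())

    ∈-link : ∀ {U} → U ∈ link → ∃ λ S → S ∈ F × A ⊆ S × U ≡ S ─ A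
    ∈-link i with ∈-map⁻ (_─ A) i
    ... | S , j , e = S , proj₁ (∈-star j) , proj₂ (∈-star j) , e

    link-small : ∀ {U} → U ∈ link → ∣ U ∣ < 2 ^ L
    link-small i with ∈-link i
    ... | S , S∈ , _ , refl = ≤-<-trans (∣p─q∣≤∣p∣ S A) (subst (_< 2 ^ L) (sym (All.lookup F-size S∈)) k<2^L)

    -- A set meeting `A` lies in no member of the link, and the empty set is trivial. Otherwise
    -- `T ∪ A` strictly contains `A`, so by maximality it is not heavy, and its weight is at most
    -- `R ^ k`, which is below the weight of `A`.
    link-spread : ∀ T → ∑ link (λ U → 𝟙 (T ⊆? U)) * R ^ ∣ T ∣ ≤ length link
    link-spread T with nonempty? (T ∩ A) | nonempty? T
    ... | yes (x , x∈) | _ = ≤-trans (≤-reflexive (cong (_* R ^ ∣ T ∣) none)) z≤n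
      where
      none : ∑ link (λ U → 𝟙 (T ⊆? U)) ≡ 0
      none = n≤0⇒n≡0 (≤-trans
        (∑-mono-∈ link {g = λ _ → 0} (λ {U} U∈ → ≤-reflexive (𝟙-no {P = T ⊆ U}
          (λ T⊆U → case ∈-link U∈ of λ { (S , _ , _ , refl) → ∈─⇒∉ S A (T⊆U (proj₁ (x∈p∩q⁻ T A x∈))) (proj₂ (x∈p∩q⁻ T A x∈)) })
          (T ⊆? U))))
        (≤-reflexive (trans (∑-const link 0) (*-zeroʳ (length link)))))
    ... | no _ | no T-empty rewrite Empty-unique T-empty | ∣⊥∣≡0 n = begin
      ∑ link (λ U → 𝟙 (⊥ ⊆? U)) * 1   ≡⟨ *-identityʳ _ ⟩
      ∑ link (λ U → 𝟙 (⊥ ⊆? U))       ≤⟨ ∑-mono link (λ U → 𝟙≤1 (⊥ ⊆? U)) ⟩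
      ∑ link (λ _ → 1)                ≡⟨ trans (∑-const link 1) (*-identityʳ _) ⟩
      length link                     ∎
      where open ≤-Reasoning
    ... | no T∩A-empty | yes (x , x∈T) = *-cancelʳ-≤ _ _ (R ^ ∣ A ∣) {{m^n≢0 R ∣ A ∣}} (begin
      ∑ link (λ U → 𝟙 (T ⊆? U)) * R ^ ∣ T ∣ * R ^ ∣ A ∣
        ≡⟨ trans (*-assoc (∑ link (λ U → 𝟙 (T ⊆? U))) _ _) (cong (∑ link (λ U → 𝟙 (T ⊆? U)) *_) (sym (^-distribˡ-+-* R ∣ T ∣ ∣ A ∣))) ⟩
      ∑ link (λ U → 𝟙 (T ⊆? U)) * R ^ (∣ T ∣ + ∣ A ∣)
        ≡⟨ cong (λ z → ∑ link (λ U → 𝟙 (T ⊆? U)) * R ^ z) (∣∪∣-disjoint T A T#A) ⟩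
      ∑ link (λ U → 𝟙 (T ⊆? U)) * R ^ ∣ T ∪ A ∣
        ≤⟨ *-monoˡ-≤ (R ^ ∣ T ∪ A ∣) degree-≤ ⟩
      length (star (T ∪ A)) * R ^ ∣ T ∪ A ∣
        ≤⟨ ≮⇒≥ (maximal (q⊆p∪q T A , x , p⊆p∪q A x∈T , T#A x∈T)) ⟩
      R ^ k
        ≤⟨ <⇒≤ heavy ⟩
      length (star A) * R ^ ∣ A ∣
        ≡⟨ cong (_* R ^ ∣ A ∣) (length-map (_─ A) (star A)) ⟨
      length link * R ^ ∣ A ∣ ∎)
      where
      open ≤-Reasoning
      T#A : Disjoint T A
      T#A i j = T∩A-empty (_ , x∈p∩q⁺ (i , j))

      degree-≤ : ∑ link (λ U → 𝟙 (T ⊆? U)) ≤ length (star (T ∪ A))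
      degree-≤ = begin
        ∑ link (λ U → 𝟙 (T ⊆? U))                ≡⟨ ∑-map (_─ A) (star A) _ ⟩
        ∑ (star A) (λ S → 𝟙 (T ⊆? (S ─ A)))
          ≤⟨ ∑-mono-∈ (star A) (λ {S} S∈ → 𝟙-mono (T ⊆? (S ─ A)) (T ∪ A ⊆? S)
               (λ T⊆ i → case x∈p∪q⁻ T A i of λ { (inj₁ j) → p─q⊆p S A (T⊆ j) ; (inj₂ j) → proj₂ (∈-star S∈) j })) ⟩
        ∑ (star A) (λ S → 𝟙 (T ∪ A ⊆? S))        ≤⟨ ∑-filter-≤ (A ⊆?_) F _ ⟩
        ∑ F (λ S → 𝟙 (T ∪ A ⊆? S))               ≡⟨ ∑-𝟙 (T ∪ A ⊆?_) F ⟩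
        length (star (T ∪ A))                    ∎

    -- A heavy set of size k would have two supersets of size k in F.
    proper : ∀ {S} → S ∈ F → A ⊆ S → Nonempty (S ─ A)
    proper {S} S∈ A⊆S with nonempty? (S ─ A)
    ... | yes ne = ne
    ... | no ¬ne = ⊥-elim (<⇒≱ heavy (begin
      length (star A) * R ^ ∣ A ∣   ≤⟨ *-monoˡ-≤ (R ^ ∣ A ∣) (Unique-constant (Unique.filter⁺ (A ⊆?_) F!) all-equal) ⟩
      1 * R ^ ∣ A ∣                 ≡⟨ trans (*-identityˡ _) (cong (R ^_) ∣A∣≡k) ⟩
      R ^ k                         ∎))
      where
      open ≤-Reasoning
      ∣A∣≡k : ∣ A ∣ ≡ k
      ∣A∣≡k = trans (cong ∣_∣ (⊆-antisym A⊆S (λ {x} x∈S → case x ∈? A of λ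
        { (yes x∈A) → x∈A ; (no x∉A) → ⊥-elim (¬ne (x , x∈p∧x∉q⇒x∈p─q x∈S x∉A)) }))) (All.lookup F-size S∈)

      all-equal : ∀ {S′} → S′ ∈ star A → S′ ≡ A
      all-equal i = sym (⊆∧∣∣≡⇒≡ (proj₂ (∈-star i)) (trans ∣A∣≡k (sym (All.lookup F-size (proj₁ (∈-star i))))))

    sunflower : HasSunflower p F
    sunflower with spread⇒disjoint link p L 0<p 0<L 0<link link-small link-spread
    ... | Us , len , Us∈ , dis =
      map (_∪ A) Us , trans (length-map (_∪ A) Us) len , AllPairs.map⁺ (AllPairs-∈ distinct dis) ,
      All.map⁺ (All.map (λ i → case ∈-link i of λ { (S , S∈ , A⊆S , refl) → subst (_∈ F) (sym (─-∪-cancel A⊆S)) S∈ }) Us∈) ,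
      A , kernel
      where
      -- Disjoint sets coincide if both are empty; `proper` supplies a point of `U` that `V ∪ A`
      -- misses.
      distinct : ∀ {U V} → U ∈ Us → V ∈ Us → Disjoint U V → U ∪ A ≢ V ∪ A
      distinct {U} {V} i j d e with ∈-link (All.lookup Us∈ i)
      ... | S , S∈ , A⊆S , refl with proper S∈ A⊆S
      ...   | x , x∈ with x∈p∪q⁻ V A (subst (x ∈ˢ_) e (p⊆p∪q A x∈))
      ...     | inj₁ x∈V = d x∈ x∈V
      ...     | inj₂ x∈A = ∈─⇒∉ S A x∈ x∈A

      kernel : ∀ {X Y} → X ∈ map (_∪ A) Us → Y ∈ map (_∪ A) Us → X ≢ Y → X ∩ Y ≡ A
      kernel i j X≢Y with ∈-map⁻ (_∪ A) i | ∈-map⁻ (_∪ A) j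
      ... | U , U∈ , refl | V , V∈ , refl with AllPairs-lookup {R = Disjoint} (λ d x∈ y∈ → d y∈ x∈) dis U∈ V∈
      ...   | inj₁ refl = ⊥-elim (X≢Y refl)
      ...   | inj₂ d    = ⊆-antisym
        (λ x∈ → let (x∈X , x∈Y) = x∈p∩q⁻ (U ∪ A) (V ∪ A) x∈ in
          case x∈p∪q⁻ U A x∈X of λ
            { (inj₂ x∈A) → x∈A
            ; (inj₁ x∈U) → case x∈p∪q⁻ V A x∈Y of λ { (inj₂ x∈A) → x∈A ; (inj₁ x∈V) → ⊥-elim (d x∈U x∈V) } })
        (λ x∈A → x∈p∩q⁺ (q⊆p∪q U A x∈A , q⊆p∪q V A x∈A))

  large⇒sunflower : R ^ k < length F → HasSunflower p F
  large⇒sunflower l with maximalHeavy n ⊥ (m≤n+m n ∣ ⊥ {n} ∣) heavy-⊥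
    where
    open ≤-Reasoning
    -- The climb starts at `⊥`, whose star is all of `F`.
    heavy-⊥ : Heavy ⊥
    heavy-⊥ = begin-strict
      R ^ k                               <⟨ l ⟩
      length F                            ≡⟨ trans (∑-const F 1) (*-identityʳ _) ⟨
      ∑ F (λ _ → 1)                       ≡⟨ ∑-cong F (λ U → sym (𝟙-⊆ {T = ⊥} {U} ⊥⊆)) ⟩
      ∑ F (λ U → 𝟙 (⊥ ⊆? U))              ≡⟨ ∑-𝟙 (⊥ ⊆?_) F ⟩
      length (star ⊥)                     ≡⟨ *-identityʳ _ ⟨
      length (star ⊥) * 1                 ≡⟨ cong (λ z → length (star ⊥) * R ^ z) (∣⊥∣≡0 n) ⟨
      length (star ⊥) * R ^ ∣ ⊥ {n} ∣     ∎
  ... | A , heavy , maximal = Kernel.sunflower A heavy maximal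

sunProperty : ∀ {p k L} → 0 < p → 0 < L → k < 2 ^ L → SunProperty p k (suc ((16 * (2 * p * L)) ^ k))
sunProperty {p} {k} {L} 0<p 0<L k<2^L n F F! F-size l = large⇒sunflower F k p L F! F-size 0<p 0<L k<2^L l

-- Decidability of the sunflower property

_≟ˢ_ : ∀ {n} (A B : Subset n) → Dec (A ≡ B)
_≟ˢ_ = ≡-dec Bool._≟_

words : ∀ {A : Set} → List A → ℕ → List (List A)
words xs zero    = [] ∷ []
words xs (suc k) = cartesianProductWith _∷_ xs (words xs k)

∈-words : ∀ {A : Set} {xs ys : List A} → All (_∈ xs) ys → ys ∈ words xs (length ys)
∈-words []       = here refl
∈-words (i ∷ is) = ∈-cartesianProductWith⁺ _∷_ i (∈-words is)

unique? : ∀ {n} → Decidable (Unique {A = Subset n})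
unique? = AllPairs.allPairs? λ A B → ¬? (A ≟ˢ B)

hasSunflower? : ∀ {n} p (F : List (Subset n)) → Dec (HasSunflower p F)
hasSunflower? {n} p F = map′
  (λ h → let S , _ , w = find h in S , w)
  (λ { (S , refl , w@(_ , S⊆F , _)) → lose (∈-words S⊆F) (refl , w) })
  (Any.any? (λ S → (length S ≟ p) ×-dec unique? S ×-dec All.all? (λ A → Any.any? (A ≟ˢ_) F) S ×-dec kernel? S) (words F p))
  where
  kernel? : ∀ S → Dec (Σ (Subset n) λ Y → ∀ {A B} → A ∈ S → B ∈ S → A ≢ B → A ∩ B ≡ Y)
  kernel? S = anySubset? λ Y → map′
    (λ h {A} {B} i j → All.lookup (All.lookup h i) j)
    (λ h → All.tabulate λ i → All.tabulate λ j → h i j)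
    (All.all? (λ A → All.all? (λ B → ¬? (A ≟ˢ B) →-dec ((A ∩ B) ≟ˢ Y)) S) S)

HasSunflower-mono : ∀ {n p} {F G : List (Subset n)} → All (_∈ F) G → HasSunflower p G → HasSunflower p F
HasSunflower-mono G⊆F (S , len , S! , S⊆G , w) = S , len , S! , All.map (All.lookup G⊆F) S⊆G , w

extend : ∀ {n} → Fin (suc n) → Subset n → Subset (suc n)
extend x A = insertAt A x false

extend-∩ : ∀ {n} x (A B : Subset n) → extend x A ∩ extend x B ≡ extend x (A ∩ B)
extend-∩ zero    A       B       = refl
extend-∩ (suc x) (a ∷ A) (b ∷ B) = cong (_ ∷_) (extend-∩ x A B)

∣extend∣ : ∀ {n} x (A : Subset n) → ∣ extend x A ∣ ≡ ∣ A ∣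
∣extend∣ zero    A           = refl
∣extend∣ (suc x) (true ∷ A)  = cong suc (∣extend∣ x A)
∣extend∣ (suc x) (false ∷ A) = ∣extend∣ x A

extend-injective : ∀ {n} x {A B : Subset n} → extend x A ≡ extend x B → A ≡ B
extend-injective x {A} {B} e =
  trans (sym (removeAt-insertAt A x false)) (trans (cong (λ C → removeAt C x) e) (removeAt-insertAt B x false))

extend-removeAt : ∀ {n} x (A : Subset (suc n)) → x ∉ˢ A → extend x (removeAt A x) ≡ A
extend-removeAt x A x∉ = trans (cong (insertAt (removeAt A x) x) (sym (lookup≡false (lookup A x) refl))) (insertAt-removeAt A x)
  where
  lookup≡false : ∀ b → lookup A x ≡ b → lookup A x ≡ false
  lookup≡false true  e = ⊥-elim (x∉ (lookup⇒[]= x A e))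
  lookup≡false false e = e

-- Inserting an absent point is injective and commutes with intersection, so it carries petals to
-- petals and the kernel to the kernel.
HasSunflower-extend : ∀ {n p} x {F : List (Subset n)} → HasSunflower p F → HasSunflower p (map (extend x) F)
HasSunflower-extend x (S , len , S! , S⊆F , Y , h) =
  map (extend x) S , trans (length-map (extend x) S) len , Unique.map⁺ (extend-injective x) S! ,
  All.map⁺ (All.map (∈-map⁺ (extend x)) S⊆F) , extend x Y , kernel
  where
  kernel : ∀ {A B} → A ∈ map (extend x) S → B ∈ map (extend x) S → A ≢ B → A ∩ B ≡ extend x Y
  kernel i j A≢B with ∈-map⁻ (extend x) i | ∈-map⁻ (extend x) j
  ... | A , A∈ , refl | B , B∈ , refl =
    trans (extend-∩ x A B) (cong (extend x) (h A∈ B∈ (A≢B ∘ cong (extend x))))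

∣∪∣≤ : ∀ {n} (p q : Subset n) → ∣ p ∪ q ∣ ≤ ∣ p ∣ + ∣ q ∣
∣∪∣≤ []          []          = z≤n
∣∪∣≤ (true ∷ p)  (true ∷ q)  = s≤s (≤-trans (∣∪∣≤ p q) (+-monoʳ-≤ ∣ p ∣ (n≤1+n _)))
∣∪∣≤ (true ∷ p)  (false ∷ q) = s≤s (∣∪∣≤ p q)
∣∪∣≤ (false ∷ p) (true ∷ q)  = ≤-trans (s≤s (∣∪∣≤ p q)) (≤-reflexive (sym (+-suc ∣ p ∣ ∣ q ∣)))
∣∪∣≤ (false ∷ p) (false ∷ q) = ∣∪∣≤ p q

∣⋃∣≤ : ∀ {n k} {F : List (Subset n)} → All (λ A → ∣ A ∣ ≡ k) F → ∣ ⋃ F ∣ ≤ length F * k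
∣⋃∣≤ {n} []  = ≤-reflexive (∣⊥∣≡0 n)
∣⋃∣≤ {F = A ∷ F} (e ∷ es) = ≤-trans (∣∪∣≤ A (⋃ F)) (+-mono-≤ (≤-reflexive e) (∣⋃∣≤ es))

∈-⋃ : ∀ {n} {F : List (Subset n)} {A x} → A ∈ F → x ∈ˢ A → x ∈ˢ ⋃ F
∈-⋃ {F = A ∷ F} (here refl) x∈ = p⊆p∪q (⋃ F) x∈
∈-⋃ {F = A ∷ F} (there i)   x∈ = q⊆p∪q A (⋃ F) (∈-⋃ i x∈)

∣∣<n⇒∃∉ : ∀ {n} (p : Subset n) → ∣ p ∣ < n → ∃ λ x → x ∉ˢ p
∣∣<n⇒∃∉ (false ∷ p) _       = zero , λ ()
∣∣<n⇒∃∉ (true ∷ p)  (s≤s l) with ∣∣<n⇒∃∉ p l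
... | x , x∉ = suc x , λ { (there i) → x∉ i }

module _ (p k s : ℕ) where

  private
    Good : ∀ {n} → List (Subset n) → Set
    Good F = Unique F → All (λ A → ∣ A ∣ ≡ k) F → s ≤ length F → HasSunflower p F

    -- A finite test: longer families can be cut down to `s` members, and by `shrink` ground sets of
    -- up to `s * k` points, inclusive, suffice.
    Bounded : Set
    Bounded = All (λ n → All Good (words (subsets n) s)) (upTo (suc (s * k)))

    bounded? : Dec Bounded
    bounded? = All.all? (λ n → All.all? (λ F →
      unique? F →-dec All.all? (λ A → ∣ A ∣ ≟ k) F →-dec s ≤? length F →-dec hasSunflower? p F) (words (subsets n) s)) _

    -- s sets of size k cover at most s * k points, and an uncovered point can be removed.
    shrink : Bounded → ∀ n (F : List (Subset n)) → length F ≡ s → Unique F → All (λ A → ∣ A ∣ ≡ k) F → HasSunflower p F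
    shrink h n F refl F! F-size with n ≤? s * k
    ... | yes l = All.lookup (All.lookup h (∈-upTo⁺ (s≤s l))) (∈-words (All.tabulate (λ {A} _ → ∈-subsets A))) F! F-size ≤-refl
    shrink h zero    F refl F! F-size | no ¬l = ⊥-elim (¬l z≤n)
    shrink h (suc n) F refl F! F-size | no ¬l with ∣∣<n⇒∃∉ (⋃ F) (≤-<-trans (∣⋃∣≤ F-size) (≰⇒> ¬l))
    ... | x , x∉ = subst (HasSunflower p) F≡ (HasSunflower-extend x (shrink h n F′ (length-map (λ A → removeAt A x) F)
                     (Unique.map⁻ (subst Unique (sym F≡) F!))
                     (All.map⁺ (All.tabulate λ {A} A∈ → trans (sym (∣extend∣ x _))
                       (trans (cong ∣_∣ (restore A∈)) (All.lookup F-size A∈))))))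
      where
      F′ : List (Subset n)
      F′ = map (λ A → removeAt A x) F

      restore : ∀ {A} → A ∈ F → extend x (removeAt A x) ≡ A
      restore {A} A∈ = extend-removeAt x A (x∉ ∘ ∈-⋃ A∈)

      F≡ : map (extend x) F′ ≡ F
      F≡ = trans (sym (map-∘ F)) (map-id-local (All.tabulate restore))

  -- `IsSun` asks for a least value; finding it constructively requires deciding a property that
  -- ranges over all ground sets.
  sunProperty? : Dec (SunProperty p k s)
  sunProperty? = map′ from to bounded?
    where
    from : Bounded → SunProperty p k s
    from h n F F! F-size l = HasSunflower-mono (All.take⁺ s (All.tabulate (λ i → i)))
      (shrink h n (take s F) (trans (length-take s F) (m≤n⇒m⊓n≡m l)) (Unique.take⁺ s F!) (All.take⁺ s F-size))

    to : SunProperty p k s → Bounded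
    to h = All.tabulate λ {n} _ → All.tabulate λ {F} _ → h n F

-- Upward search from 0; `f` is the remaining distance to the known solution `b`, and every solution
-- is at least the current `i`.
least : ∀ {P : ℕ → Set} → Decidable P → ∀ {b} → P b → ∃ λ s → P s × (∀ s′ → P s′ → s ≤ s′)
least {P} P? {b} Pb = go b 0 (subst P (sym (+-identityʳ b)) Pb) (λ _ _ → z≤n)
  where
  go : ∀ f i → P (f + i) → (∀ s′ → P s′ → i ≤ s′) → ∃ λ s → P s × (∀ s′ → P s′ → s ≤ s′)
  go f i Pf below with P? i
  ... | yes Pi = i , Pi , below
  go zero    i Pf below | no ¬Pi = ⊥-elim (¬Pi Pf)
  go (suc f) i Pf below | no ¬Pi = go f (suc i) (subst P (sym (+-suc f i)) Pf)
    (λ s′ Ps′ → ≤∧≢⇒< (below s′ Ps′) (λ { refl → ¬Pi Ps′ }))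

-- Comparison with the natural logarithm

⌊log₂⌋-spec : ∀ k → ∃ λ ℓ → 2 ^ ℓ ≤ suc k × suc k < 2 ^ suc ℓ
⌊log₂⌋-spec zero = 0 , s≤s z≤n , s≤s (s≤s z≤n)
⌊log₂⌋-spec (suc k) with ⌊log₂⌋-spec k
... | ℓ , lo , hi with suc (suc k) <? 2 ^ suc ℓ
...   | yes l = ℓ , m≤n⇒m≤1+n lo , l
...   | no ¬l = suc ℓ , ≮⇒≥ ¬l , ≤-<-trans hi (^-monoʳ-< 2 (s≤s (s≤s z≤n)) (n<1+n (suc ℓ)))

-- Bernoulli's inequality (1 - 1/(j+1))^a ≥ 1 - a/(j+1), with d = j - a.
bernoulli : ∀ a d → suc (a + d) ^ a * suc d ≤ (a + d) ^ a * suc (a + d)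
bernoulli a d = go a d refl
  where
  open ≤-Reasoning
  open +-*-Solver
  go : ∀ a d {j} → a + d ≡ j → suc j ^ a * suc d ≤ j ^ a * suc j
  go zero    d refl = ≤-refl
  go (suc a) d {j} e = begin
    suc j * suc j ^ a * suc d     ≡⟨ solve 3 (λ x y z → x :* y :* z := y :* (x :* z)) refl (suc j) (suc j ^ a) (suc d) ⟩
    suc j ^ a * (suc j * suc d)   ≤⟨ *-monoʳ-≤ (suc j ^ a) step ⟩
    suc j ^ a * (suc (suc d) * j) ≡⟨ *-assoc (suc j ^ a) (suc (suc d)) j ⟨
    suc j ^ a * suc (suc d) * j   ≤⟨ *-monoˡ-≤ j (go a (suc d) (trans (+-suc a d) e)) ⟩
    j ^ a * suc j * j             ≡⟨ solve 3 (λ x y z → y :* z :* x := x :* y :* z) refl j (j ^ a) (suc j) ⟩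
    j * j ^ a * suc j             ∎
    where
    step : suc j * suc d ≤ suc (suc d) * j
    step = begin
      suc j * suc d       ≡⟨ cong (suc d +_) (*-comm j (suc d)) ⟩
      suc d + suc d * j   ≤⟨ +-monoˡ-≤ (suc d * j) (subst (suc d ≤_) e (s≤s (m≤n+m d a))) ⟩
      j + suc d * j       ∎

-- With `j = a + d`, the hypothesis makes `suc j` at most `2 * suc d`, so the factor `suc d / suc j`
-- in Bernoulli's inequality is at least 1/2.
[1+j]^a≤2*j^a : ∀ a d → a ≤ suc d → suc (a + d) ^ a ≤ 2 * (a + d) ^ a
[1+j]^a≤2*j^a a d l = *-cancelʳ-≤ _ _ (suc (a + d)) (begin
  suc (a + d) ^ a * suc (a + d)         ≤⟨ *-monoʳ-≤ (suc (a + d) ^ a) (s≤s (+-monoˡ-≤ d l)) ⟩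
  suc (a + d) ^ a * (suc (suc d) + d)   ≡⟨ solve 2 (λ x d → x :* (con 2 :+ d :+ d) := con 2 :* (x :* (con 1 :+ d))) refl (suc (a + d) ^ a) d ⟩
  2 * (suc (a + d) ^ a * suc d)         ≤⟨ *-monoʳ-≤ 2 (bernoulli a d) ⟩
  2 * ((a + d) ^ a * suc (a + d))       ≡⟨ *-assoc 2 ((a + d) ^ a) (suc (a + d)) ⟨
  2 * (a + d) ^ a * suc (a + d)         ∎)
  where
  open ≤-Reasoning
  open +-*-Solver

⌈n/2⌉≤1+⌊n/2⌋ : ∀ n → ⌈ n /2⌉ ≤ suc ⌊ n /2⌋
⌈n/2⌉≤1+⌊n/2⌋ zero          = z≤n
⌈n/2⌉≤1+⌊n/2⌋ (suc zero)    = s≤s z≤n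
⌈n/2⌉≤1+⌊n/2⌋ (suc (suc n)) = s≤s (⌈n/2⌉≤1+⌊n/2⌋ n)

-- The exponent is halved, and each half costs a factor 2. For odd `j` the larger half exceeds the
-- smaller by one, which the bound `a ≤ suc d` just allows.
[1+j]^j≤4*j^j : ∀ j → suc j ^ j ≤ 4 * j ^ j
[1+j]^j≤4*j^j j = begin
  suc j ^ j                         ≡⟨ cong (suc j ^_) (⌊n/2⌋+⌈n/2⌉≡n j) ⟨
  suc j ^ (f + c)                   ≡⟨ ^-distribˡ-+-* (suc j) f c ⟩
  suc j ^ f * suc j ^ c             ≤⟨ *-mono-≤ lower upper ⟩
  (2 * j ^ f) * (2 * j ^ c)         ≡⟨ solve 2 (λ x y → (con 2 :* x) :* (con 2 :* y) := con 4 :* (x :* y)) refl (j ^ f) (j ^ c) ⟩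
  4 * (j ^ f * j ^ c)               ≡⟨ cong (4 *_) (^-distribˡ-+-* j f c) ⟨
  4 * j ^ (f + c)                   ≡⟨ cong (λ z → 4 * j ^ z) (⌊n/2⌋+⌈n/2⌉≡n j) ⟩
  4 * j ^ j                         ∎
  where
  open ≤-Reasoning
  open +-*-Solver
  f = ⌊ j /2⌋
  c = ⌈ j /2⌉

  lower : suc j ^ f ≤ 2 * j ^ f
  lower = subst (λ z → suc z ^ f ≤ 2 * z ^ f) (⌊n/2⌋+⌈n/2⌉≡n j)
    ([1+j]^a≤2*j^a f c (m≤n⇒m≤1+n (⌊n/2⌋≤⌈n/2⌉ j)))

  upper : suc j ^ c ≤ 2 * j ^ c
  upper = subst (λ z → suc z ^ c ≤ 2 * z ^ c) (trans (+-comm c f) (⌊n/2⌋+⌈n/2⌉≡n j))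
    ([1+j]^a≤2*j^a c f (⌈n/2⌉≤1+⌊n/2⌋ j))

-- e ≤ 4, so a failure of e^m ≤ k^n forces k^n < 4^m.
¬ExpLe⇒<4^ : ∀ {m K i} → K * suc i ^ (suc i * m) < suc (suc i) ^ (suc i * m) → K < 4 ^ m
¬ExpLe⇒<4^ {m} {K} {i} l = *-cancelʳ-< (j ^ (j * m)) K (4 ^ m) (begin-strict
  K * j ^ (j * m)          <⟨ l ⟩
  suc j ^ (j * m)          ≡⟨ ^-*-assoc (suc j) j m ⟨
  (suc j ^ j) ^ m          ≤⟨ ^-monoˡ-≤ m ([1+j]^j≤4*j^j j) ⟩
  (4 * j ^ j) ^ m          ≡⟨ ^-distribʳ-* 4 (j ^ j) m ⟩
  4 ^ m * (j ^ j) ^ m      ≡⟨ cong (4 ^ m *_) (^-*-assoc j j m) ⟩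
  4 ^ m * j ^ (j * m)      ∎)
  where
  open ≤-Reasoning
  j = suc i

-- By contraposition: if `e^m ≤ k^n` fails, then `2 ^ (ℓ * n) ≤ k ^ n < 4 ^ m`, so `ℓ * n < 2 * m`,
-- which makes `m / n` too large for the hypothesis `H`.
leCpLogPow : ∀ {s p k ℓ} → 0 < p → 0 < ℓ → 1 ≤ k → 2 ^ ℓ ≤ k → s ≤ suc ((16 * (2 * p * suc ℓ)) ^ k) → LeCpLogPow s 256 p k
leCpLogPow {s} {p} {k} {ℓ} 0<p 0<ℓ 1≤k 2^ℓ≤k s≤ m n 1≤n H i =
  ≮⇒≥ λ l → <⇒≱ H (bound (ℓn<2m (¬ExpLe⇒<4^ {m} {k ^ n} {i} l)))
  where
  open ≤-Reasoning
  open +-*-Solver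
  R = 16 * (2 * p * suc ℓ)

  instance
    R≢0 : NonZero R
    R≢0 = m*n≢0 16 (2 * p * suc ℓ) {{_}} {{m*n≢0 (2 * p) (suc ℓ) {{m*n≢0 2 p {{_}} {{>-nonZero 0<p}}}}}}

  ℓn<2m : k ^ n < 4 ^ m → ℓ * n < 2 * m
  ℓn<2m l = ≰⇒> λ 2m≤ℓn → <⇒≱ l (begin
    4 ^ m         ≡⟨ ^-*-assoc 2 2 m ⟩
    2 ^ (2 * m)   ≤⟨ ^-monoʳ-≤ 2 2m≤ℓn ⟩
    2 ^ (ℓ * n)   ≡⟨ ^-*-assoc 2 ℓ n ⟨
    (2 ^ ℓ) ^ n   ≤⟨ ^-monoˡ-≤ n 2^ℓ≤k ⟩
    k ^ n         ∎)

  s≤[2R]^k : s ≤ (2 * R) ^ k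
  s≤[2R]^k = begin
    s                   ≤⟨ s≤ ⟩
    -- The extra 1 is absorbed by doubling the base, since `k ≥ 1`.
    1 + R ^ k           ≤⟨ +-monoˡ-≤ (R ^ k) (m^n>0 R k) ⟩
    R ^ k + R ^ k       ≡⟨ cong (R ^ k +_) (+-identityʳ (R ^ k)) ⟨
    2 * R ^ k           ≤⟨ *-monoˡ-≤ (R ^ k) (^-monoʳ-≤ 2 1≤k) ⟩
    2 ^ k * R ^ k       ≡⟨ ^-distribʳ-* 2 R k ⟨
    (2 * R) ^ k         ∎

  bound : ℓ * n < 2 * m → s * n ^ k ≤ (m * 256 * p) ^ k
  bound l = begin
    s * n ^ k               ≤⟨ *-monoˡ-≤ (n ^ k) s≤[2R]^k ⟩
    (2 * R) ^ k * n ^ k     ≡⟨ ^-distribʳ-* (2 * R) n k ⟨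
    (2 * R * n) ^ k         ≤⟨ ^-monoˡ-≤ k base ⟩
    (m * 256 * p) ^ k       ∎
    where
    base : 2 * R * n ≤ m * 256 * p
    base = begin
      2 * R * n                     ≡⟨ regroup 16 p (suc ℓ) n ⟩
      -- The constant 256 is 64 times 2 from `suc ℓ ≤ 2 * ℓ`, for which `ℓ` must be positive, times
      -- 2 from `ℓ * n < 2 * m`.
      64 * p * (suc ℓ * n)          ≤⟨ *-monoʳ-≤ (64 * p) (*-monoˡ-≤ n (+-monoˡ-≤ ℓ 0<ℓ)) ⟩
      64 * p * ((ℓ + ℓ) * n)        ≡⟨ cong (64 * p *_) (solve 2 (λ ℓ n → (ℓ :+ ℓ) :* n := con 2 :* (ℓ :* n)) refl ℓ n) ⟩
      64 * p * (2 * (ℓ * n))        ≤⟨ *-monoʳ-≤ (64 * p) (*-monoʳ-≤ 2 (<⇒≤ l)) ⟩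
      64 * p * (2 * (2 * m))        ≡⟨ regroup′ 64 p m ⟩
      m * 256 * p                   ∎
      where
      regroup : ∀ a p ℓ n → 2 * (a * (2 * p * ℓ)) * n ≡ a * 4 * p * (ℓ * n)
      regroup = solve 4 (λ a p ℓ n → con 2 :* (a :* (con 2 :* p :* ℓ)) :* n := a :* con 4 :* p :* (ℓ :* n)) refl

      regroup′ : ∀ a p m → a * p * (2 * (2 * m)) ≡ m * (a * 4) * p
      regroup′ = solve 3 (λ a p m → a :* p :* (con 2 :* (con 2 :* m)) := m :* (a :* con 4) :* p) refl

theorem1 : Σ ℕ λ C → 4 ≤ C ×
    (∀ (p k : ℕ) → 2 ≤ p → 2 ≤ k →
    Σ ℕ λ s → IsSun p k s × LeCpLogPow s C p k)
theorem1 = 256 , m≤m+n 4 252 , λ { p (suc k) 2≤p 2≤k → bound p k 2≤p 2≤k (⌊log₂⌋-spec k) }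
  where
  bound : ∀ p k → 2 ≤ p → 2 ≤ suc k → (∃ λ ℓ → 2 ^ ℓ ≤ suc k × suc k < 2 ^ suc ℓ) →
          Σ ℕ λ s → IsSun p (suc k) s × LeCpLogPow s 256 p (suc k)
  -- A zero logarithm would force `suc k < 2`.
  bound p k 2≤p 2≤k (zero , _ , hi) = ⊥-elim (<⇒≱ hi 2≤k)
  bound p k 2≤p 2≤k (suc ℓ , lo , hi) =
    let 0<p = <⇒≤ 2≤p
        P   = sunProperty {p} {suc k} {suc (suc ℓ)} 0<p (s≤s z≤n) hi
        s , Ps , s-least = least (sunProperty? p (suc k)) P
    in s , (Ps , s-least) , leCpLogPow {s} {p} {suc k} {suc ℓ} 0<p (s≤s z≤n) (s≤s z≤n) lo (s-least _ P)
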